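{- The record-setters $v$ of the Stern sequence with $2^{k-1}\le v<2^k$ (the "$k$-bit record-setters") are, for $k<12$: $k=1$: $1$; $k=2$: $3$; $k=3$: $5$; $k=4$: $9, 11$; $k=5$: $19, 21$; $k=6$: $35, 37, 43$; $k=7$: $69, 73, 75, 83, 85$; $k=8$: $139, 147, 149, 165, 171$; $k=9$: $277, 293, 299, 331, 339, 341$; $k=10$: $555, 587, 595, 597, 661, 683$; $k=11$: $1109, 1173, 1189, 1195, 1323, 1355, 1363, 1365$. For $k\ge 12$, the $k$-bit record-setters, listed in increasing order, have the following base-$2$ representations: - if $k=2n$ is even: $100\,(10)^a\,0\,(10)^{n-3-a}\,11$ for $0\le a\le n-3$; then $(10)^b\,0\,(10)^{n-b-1}\,1$ for $1\le b\le\lfloor n/2\rfloor$; then $(10)^{n-1}\,11$. - if $k=2n+1$ is odd: $1000\,(10)^{n-2}\,1$; then $100100\,(10)^{n-4}\,011$; then $100\,(10)^b\,0\,(10)^{n-2-b}\,1$ for $1\le b\le\lceil n/2\rceil-1$; then $(10)^{a+1}\,0\,(10)^{n-2-a}\,11$ for $0\le a\le n-2$; then $(10)^n\,1$. In particular, for $k\ge 12$ the number of $k$-bit record-setters is $\lfloor 3k/4\rfloor-(-1)^k$. -}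

module Defs where

open import Data.Digit using (0b; 1b; Expansion; fromDigits)
open import Data.List using (List; []; _∷_; [_]; _++_; concat; filter; length; map; replicate; reverse; upTo)
open import Data.List.Membership.Propositional using (_∈_)
open import Data.List.Relation.Unary.Linked using (Linked)
open import Data.Nat using (ℕ; zero; suc; _+_; _*_; _∸_; _^_; _≤_; _<_; ⌊_/2⌋; ⌈_/2⌉; s≤s)
open import Data.Nat.Induction using (<-wellFounded; <-rec)
open import Data.Nat.Properties using (_≤?_; _<?_; allUpTo?; +-suc; +-identityʳ; n≡⌊n+n/2⌋; ⌊n/2⌋≤n; ⌈n/2⌉≤n)
open import Data.Product using (_×_)
open import Function using (_⇔_)
open import Induction.WellFounded using (module FixPoint)
open import Relation.Binary.PropositionalEquality using (_≡_; refl; sym; trans; cong; cong₂)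
open import Relation.Nullary using (Dec)
open import Relation.Nullary.Decidable using (_×-dec_)

data Parity : Set where
  even odd : Parity

parity : ℕ → Parity
parity zero          = even
parity (suc zero)    = odd
parity (suc (suc n)) = parity n

-- For N = m + 2: suc ⌊ m /2⌋ = ⌊ N /2⌋ and suc ⌈ m /2⌉ = ⌈ N /2⌉, the latter being
-- ⌊ N /2⌋ + 1 when N is odd.
sternStep : ∀ N → (∀ {i} → i < N → ℕ) → ℕ
sternStep zero          s = 0
sternStep (suc zero)    s = 1
sternStep (suc (suc m)) s with parity m
... | even = s {suc ⌊ m /2⌋} (s≤s (s≤s (⌊n/2⌋≤n m)))
... | odd  = s {suc ⌊ m /2⌋} (s≤s (s≤s (⌊n/2⌋≤n m))) + s {suc ⌈ m /2⌉} (s≤s (s≤s (⌈n/2⌉≤n m)))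

-- The Stern sequence; its usual defining equations are stern-zero, stern-one,
-- stern-even and stern-odd below.
stern : ℕ → ℕ
stern = <-rec (λ _ → ℕ) sternStep

private
  sternStep-ext : ∀ N {s t : ∀ {i} → i < N → ℕ} →
                  (∀ {i} (i<N : i < N) → s i<N ≡ t i<N) → sternStep N s ≡ sternStep N t
  sternStep-ext zero          s≗t = refl
  sternStep-ext (suc zero)    s≗t = refl
  sternStep-ext (suc (suc m)) s≗t with parity m
  ... | even = s≗t _
  ... | odd  = cong₂ _+_ (s≗t _) (s≗t _)

  unfold : ∀ {N} → stern N ≡ sternStep N (λ {i} _ → stern i)
  unfold {N} = FixPoint.unfold-wfRec <-wellFounded (λ _ → ℕ) sternStep sternStep-ext {N}

  parity-n+n : ∀ n → parity (n + n) ≡ even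
  parity-n+n zero = refl
  parity-n+n (suc n) rewrite +-suc n n = parity-n+n n

  parity-1+n+n : ∀ n → parity (suc (n + n)) ≡ odd
  parity-1+n+n zero = refl
  parity-1+n+n (suc n) rewrite +-suc n n = parity-1+n+n n

  ⌈n+n/2⌉≡n : ∀ n → ⌈ n + n /2⌉ ≡ n
  ⌈n+n/2⌉≡n zero = refl
  ⌈n+n/2⌉≡n (suc n) rewrite +-suc n n = cong suc (⌈n+n/2⌉≡n n)

stern-zero : stern 0 ≡ 0
stern-zero = refl

stern-one : stern 1 ≡ 1
stern-one = refl

stern-even : ∀ n → stern (2 * n) ≡ stern n
stern-even zero = refl
stern-even (suc n) rewrite +-identityʳ n | +-suc n n = trans (unfold {suc (suc (n + n))}) step
  where
  step : sternStep (suc (suc (n + n))) (λ {i} _ → stern i) ≡ stern (suc n)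
  step rewrite parity-n+n n = cong (λ h → stern (suc h)) (sym (n≡⌊n+n/2⌋ n))

stern-odd : ∀ n → stern (suc (2 * n)) ≡ stern n + stern (suc n)
stern-odd zero = refl
stern-odd (suc n) rewrite +-identityʳ n | +-suc n n = trans (unfold {suc (suc (suc (n + n)))}) step
  where
  step : sternStep (suc (suc (suc (n + n)))) (λ {i} _ → stern i) ≡ stern (suc n) + stern (suc (suc n))
  step rewrite parity-1+n+n n = cong₂ (λ g h → stern (suc g) + stern (suc (suc h))) (⌈n+n/2⌉≡n n) (sym (n≡⌊n+n/2⌋ n))

RecordSetter : ℕ → Set
RecordSetter v = ∀ {i} → i < v → stern i < stern v

-- Intended for k ≥ 1; with truncated subtraction no number satisfies it for k = 0.
KBitRecordSetter : ℕ → ℕ → Set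
KBitRecordSetter k v = 2 ^ (k ∸ 1) ≤ v × v < 2 ^ k × RecordSetter v

kBitRecordSetter? : ∀ k v → Dec (KBitRecordSetter k v)
kBitRecordSetter? k v =
  2 ^ (k ∸ 1) ≤? v ×-dec v <? 2 ^ k ×-dec allUpTo? (λ i → stern i <? stern v) v

numberOfKBitRecordSetters : ℕ → ℕ
numberOfKBitRecordSetters k = length (filter (kBitRecordSetter? k) (upTo (2 ^ k)))

KBitRecordSettersInOrder : ℕ → List ℕ → Set
KBitRecordSettersInOrder k vs = Linked _<_ vs × (∀ v → v ∈ vs ⇔ KBitRecordSetter k v)

-- Words are written most significant bit first.
Word : Set
Word = Expansion 2

-- fromDigits expects the least significant digit first.
value : Word → ℕ
value w = fromDigits (reverse w)

⟨10⟩^_ : ℕ → Word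
⟨10⟩^ m = concat (replicate m (1b ∷ 0b ∷ []))

infix 8 ⟨10⟩^_

-- The integers lo, lo + 1, …, hi.
range : ℕ → ℕ → List ℕ
range lo hi = map (lo +_) (upTo (suc hi ∸ lo))

evenWords : ℕ → List Word
evenWords n =
     map (λ a → (1b ∷ 0b ∷ 0b ∷ []) ++ ⟨10⟩^ a ++ [ 0b ] ++ ⟨10⟩^ (n ∸ 3 ∸ a) ++ (1b ∷ 1b ∷ []))
         (range 0 (n ∸ 3))
  ++ map (λ b → ⟨10⟩^ b ++ [ 0b ] ++ ⟨10⟩^ (n ∸ b ∸ 1) ++ [ 1b ])
         (range 1 ⌊ n /2⌋)
  ++ [ ⟨10⟩^ (n ∸ 1) ++ (1b ∷ 1b ∷ []) ]

oddWords : ℕ → List Word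
oddWords n =
     [ (1b ∷ 0b ∷ 0b ∷ 0b ∷ []) ++ ⟨10⟩^ (n ∸ 2) ++ [ 1b ] ]
  ++ [ (1b ∷ 0b ∷ 0b ∷ 1b ∷ 0b ∷ 0b ∷ []) ++ ⟨10⟩^ (n ∸ 4) ++ (0b ∷ 1b ∷ 1b ∷ []) ]
  ++ map (λ b → (1b ∷ 0b ∷ 0b ∷ []) ++ ⟨10⟩^ b ++ [ 0b ] ++ ⟨10⟩^ (n ∸ 2 ∸ b) ++ [ 1b ])
         (range 1 (⌈ n /2⌉ ∸ 1))
  ++ map (λ a → ⟨10⟩^ (a + 1) ++ [ 0b ] ++ ⟨10⟩^ (n ∸ 2 ∸ a) ++ (1b ∷ 1b ∷ []))
         (range 0 (n ∸ 2))
  ++ [ ⟨10⟩^ n ++ [ 1b ] ]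

{-# OPTIONS --safe #-}
module Submission where

-- Read from the most significant bit, a word acts on pairs (stern X , stern (1 + X)) by
-- 0 : (p , q) ↦ (p , q + p) and 1 : (p , q) ↦ (p + q , q). From p ≤ q the largest value reachable
-- with m further bits is p F(m) + q F(m+1), and the first word attaining it is (10)…1 or (10)…11.
-- Every word is compared with this optimal continuation: it equals it, exceeds it (and is then
-- dominated by a smaller number), is even (dominated by its half), or has the form (10)ᵗ 0 z, to
-- whose tail z the same comparison is applied. A single inserted 0 yields the listed families,
-- whose values are compared by d'Ocagne's identity; this shows where each family stops. Words with
-- too many inserted 0s are dominated by an earlier listed word, or by the maximum of the
-- (k−1)-bit numbers, by estimates on ratios of Fibonacci numbers. A list that is increasing both
-- in value and in Stern value, and outside of which every number is dominated, consists of
-- exactly the record-setters.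

open import Defs
open import Algebra.Properties.CommutativeSemigroup using (x∙yz≈y∙xz)
open import Data.Bool using (true; false; T)
open import Data.Digit using (0b; 1b; fromDigits)
open import Data.Empty using (⊥-elim)
open import Data.Fin using (zero; suc; toℕ)
open import Data.List using (List; []; _∷_; [_]; _++_; length; reverse; map; upTo; applyUpTo)
open import Data.List.Membership.Propositional using (_∈_)
open import Data.List.Membership.Propositional.Properties using (∈-map⁺; ∈-map⁻; ∈-++⁺ˡ; ∈-++⁺ʳ; ∈-++⁻; ∈-filter⁺; ∈-filter⁻; ∈-upTo⁺)
open import Data.List.Membership.Propositional.Properties.WithK using (unique∧set⇒bag)
open import Data.List.Properties using (length-++; length-map; length-reverse; length-upTo; map-∘; map-upTo; unfold-reverse)
open import Data.List.Relation.Binary.BagAndSetEquality using (∼bag⇒↭)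
open import Data.List.Relation.Binary.Permutation.Propositional.Properties using (↭-length)
open import Data.List.Relation.Unary.AllPairs as AllPairs using ()
open import Data.List.Relation.Unary.Any using (here; there)
open import Data.List.Relation.Unary.Linked using (Linked; [-]; _∷_; linked?)
open import Data.List.Relation.Unary.Linked.Properties using (Linked⇒AllPairs)
open import Data.List.Relation.Unary.Unique.Propositional.Properties using (filter⁺; upTo⁺)
open import Data.Nat
open import Data.Nat.DivMod using (+-distrib-/-∣ʳ; m<n⇒m/n≡0; m*n/n≡m)
open import Data.Nat.Divisibility using (n∣m*n)
open import Data.Nat.Induction using (<-rec)
open import Data.Nat.Properties
open import Data.Nat.Tactic.RingSolver using (solve-∀)
open import Data.Product using (_×_; _,_; proj₁; proj₂; ∃)
open import Data.Sum using (_⊎_; inj₁; inj₂; [_,_]′)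
open import Function using (_⇔_; mk⇔; Equivalence)
open import Relation.Binary.PropositionalEquality using (_≡_; refl; sym; trans; cong; cong₂; subst; subst₂; module ≡-Reasoning)
open import Relation.Nullary using (yes; no)
open import Relation.Nullary.Decidable using (True; toWitness)

-- Fibonacci inequalities

-- The linear-arithmetic rule behind all inequalities: s is the slack left after adding l ≤ r.
≤-by : ∀ {a b l r} s → l ≤ r → a + r + s ≡ b + l → a ≤ b
≤-by {a} {b} {l} {r} s l≤r eq = +-cancelʳ-≤ r a b (begin
  a + r      ≤⟨ m≤m+n (a + r) s ⟩
  a + r + s  ≡⟨ eq ⟩
  b + l      ≤⟨ +-monoʳ-≤ b l≤r ⟩
  b + r      ∎)
  where open ≤-Reasoning

-- The Fibonacci recurrence started at r, p. Reading `10` moves a pair of consecutive terms two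
-- places along, so (10)ᵗ takes the pair (p , r + p) to the terms 1 + 2t and 2 + 2t.
gib : ℕ → ℕ → ℕ → ℕ
gib r p zero          = r
gib r p (suc zero)    = p
gib r p (suc (suc n)) = gib r p n + gib r p (suc n)

fib : ℕ → ℕ
fib = gib 0 1

fib>0 : ∀ n → 0 < fib (1 + n)
fib>0 zero    = z<s
fib>0 (suc n) = <-≤-trans (fib>0 n) (m≤n+m _ (fib n))

fib-mono : ∀ n → fib n ≤ fib (1 + n)
fib-mono zero    = z≤n
fib-mono (suc n) = m≤n+m _ (fib n)

fib≤2fib : ∀ n → fib (2 + n) ≤ 2 * fib (1 + n)
fib≤2fib n = ≤-by 0 (fib-mono n) (eq (fib n) (fib (1 + n)))
  where
  eq : ∀ f g → f + g + g + 0 ≡ 2 * g + f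
  eq = solve-∀

-- Ratios of consecutive Fibonacci numbers oscillate around the golden ratio. From `fib 4` / `fib 3`
-- on they lie between 3/2 and 5/3, both of which occur; this bound and the next are therefore
-- sharp, and their index shifts exclude the early ratios 1 and 2 respectively.
2fib-suc≥3fib : ∀ n → 3 * fib (2 + n) ≤ 2 * fib (3 + n)
2fib-suc≥3fib n = ≤-by 0 (fib-mono n) (eq (fib n) (fib (1 + n)))
  where
  eq : ∀ f g → 3 * (f + g) + g + 0 ≡ 2 * (g + (f + g)) + f
  eq = solve-∀

3fib-suc≤5fib : ∀ n → 3 * fib (4 + n) ≤ 5 * fib (3 + n)
3fib-suc≤5fib n = ≤-by 0 (fib-mono n) (eq (fib n) (fib (1 + n)))
  where
  eq : ∀ f g → 3 * (f + g + (g + (f + g))) + g + 0 ≡ 5 * (g + (f + g)) + f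
  eq = solve-∀

-- Expresses sequences with different initial values, such as `gib 7 4` and `gib 5 9`, by the same
-- two numbers, so that they can be compared by ring identities.
gib-linear : ∀ r p n → gib r p n ≡ r * gib 1 0 n + p * gib 1 0 (1 + n)
gib-linear r p zero          = eq r p
  where
  eq : ∀ r p → r ≡ r * 1 + p * 0
  eq = solve-∀
gib-linear r p (suc zero)    = eq r p
  where
  eq : ∀ r p → p ≡ r * 0 + p * 1
  eq = solve-∀
gib-linear r p (suc (suc n)) =
  trans (cong₂ _+_ (gib-linear r p n) (gib-linear r p (suc n)))
        (eq r p (gib 1 0 n) (gib 1 0 (1 + n)))
  where
  eq : ∀ r p a b → r * a + p * b + (r * b + p * (a + b)) ≡ r * (a + b) + p * (b + (a + b))
  eq = solve-∀

-- gib i fib (1+j) − gib (1+i) fib j is unchanged when i and j grow by two (d'Ocagne's identity).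
module _ (r p i j : ℕ) where

  private
    a b f g : ℕ
    a = gib r p i
    b = gib r p (1 + i)
    f = fib j
    g = fib (1 + j)

  d'Ocagne-< : b * f < a * g → gib r p (3 + i) * fib (2 + j) < gib r p (2 + i) * fib (3 + j)
  d'Ocagne-< lt = ≤-by 0 lt (eq a b f g)
    where
    eq : ∀ a b f g → suc ((b + (a + b)) * (f + g)) + a * g + 0 ≡ (a + b) * (g + (f + g)) + suc (b * f)
    eq = solve-∀

  d'Ocagne-≥ : a * g ≤ b * f → gib r p (2 + i) * fib (3 + j) ≤ gib r p (3 + i) * fib (2 + j)
  d'Ocagne-≥ le = ≤-by 0 le (eq a b f g)
    where
    eq : ∀ a b f g → (a + b) * (g + (f + g)) + b * f + 0 ≡ (b + (a + b)) * (f + g) + a * g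
    eq = solve-∀

*-mono-<-≤ : ∀ {p r f g} → p < r → f ≤ g → 0 < g → p * f < r * g
*-mono-<-≤ {p} {r} {f} {g} p<r f≤g 0<g =
  ≤-<-trans (*-monoʳ-≤ p f≤g) (*-monoˡ-< g {{>-nonZero 0<g}} p<r)

gib>0 : ∀ r p → p < r → ∀ t → 0 < gib r p (t * 2)
gib>0 r p p<r zero    = ≤-<-trans z≤n p<r
gib>0 r p p<r (suc t) = <-≤-trans (gib>0 r p p<r t) (m≤m+n _ _)

-- The descent by two in both indices ends at t = 0, where p < r decides, or at `fib 0`, where the
-- left side vanishes. Both ends give the same sign, so for an even Fibonacci index there is no
-- turning point.
gib-fib-cross-even : ∀ r p → p < r → ∀ t j →
  gib r p (1 + t * 2) * fib (j * 2) < gib r p (t * 2) * fib (1 + j * 2)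
gib-fib-cross-even r p p<r zero    j       = *-mono-<-≤ p<r (fib-mono (j * 2)) (fib>0 (j * 2))
gib-fib-cross-even r p p<r (suc t) zero    =
  subst (_< gib r p (suc t * 2) * 1) (sym (*-zeroʳ (gib r p (1 + suc t * 2))))
        (subst (0 <_) (sym (*-identityʳ _)) (gib>0 r p p<r (suc t)))
gib-fib-cross-even r p p<r (suc t) (suc j) =
  d'Ocagne-< r p (t * 2) (j * 2) (gib-fib-cross-even r p p<r t j)

-- With t at most the Fibonacci parameter, the descent reaches t = 0 first and p < r decides.
gib-fib-cross-odd-< : ∀ r p → p < r → ∀ t d →
  gib r p (1 + t * 2) * fib (1 + (t + d) * 2) < gib r p (t * 2) * fib (2 + (t + d) * 2)
gib-fib-cross-odd-< r p p<r zero    d = *-mono-<-≤ p<r (fib-mono (1 + d * 2)) (fib>0 (1 + d * 2))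
gib-fib-cross-odd-< r p p<r (suc t) d =
  d'Ocagne-< r p (t * 2) (1 + (t + d) * 2) (gib-fib-cross-odd-< r p p<r t d)

-- Past the middle the descent ends on the Fibonacci side instead, at `fib 1` and `fib 2`, both 1,
-- and the sign is reversed.
gib-fib-cross-odd-≥ : ∀ r p c e →
  gib r p ((1 + c + e) * 2) * fib (2 + c * 2) ≤ gib r p (1 + (1 + c + e) * 2) * fib (1 + c * 2)
gib-fib-cross-odd-≥ r p zero    e = *-monoˡ-≤ 1 (m≤n+m (gib r p (2 + e * 2)) (gib r p (1 + e * 2)))
gib-fib-cross-odd-≥ r p (suc c) e =
  d'Ocagne-≥ r p ((1 + c + e) * 2) (1 + c * 2) (gib-fib-cross-odd-≥ r p c e)

-- Optimal values and the position of an inserted zero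

bound : ℕ → ℕ → ℕ → ℕ
bound p q m = p * fib m + q * fib (1 + m)

bound-10 : ∀ p q m → bound (p + q) (q + (p + q)) m ≡ bound p q (2 + m)
bound-10 p q m = eq p q (fib m) (fib (1 + m))
  where
  eq : ∀ p q f g → (p + q) * f + (q + (p + q)) * g ≡ p * (f + g) + q * (g + (f + g))
  eq = solve-∀

-- The largest value reached from (gib r p 1, gib r p 2) by words (10)ᵗ 0 z with |z| = m.
inserted : ℕ → ℕ → ℕ → ℕ → ℕ
inserted r p t m = bound (gib r p (1 + t * 2)) (gib r p (2 + t * 2) + gib r p (1 + t * 2)) m

module _ (r p : ℕ) where

  private
    eq : ∀ a b f g →
      (b + (a + b)) * f + ((a + b) + (b + (a + b)) + (b + (a + b))) * g + b * f
      ≡ b * (f + g) + (a + b + b) * (g + (f + g)) + a * g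
    eq = solve-∀

  -- By `eq`, moving the inserted 0 past one more `10` changes the value by exactly ag - bf, where
  -- a, b are consecutive terms of `gib r p` and f, g are `fib m` and `fib (1 + m)`. The cross
  -- inequalities above give its sign.
  inserted-later-< : ∀ t m → gib r p (1 + t * 2) * fib m < gib r p (t * 2) * fib (1 + m) →
    inserted r p t (2 + m) < inserted r p (1 + t) m
  inserted-later-< t m lt = ≤-by 0 lt (trans (+-identityʳ _) (trans (cong suc
    (sym (eq (gib r p (t * 2)) (gib r p (1 + t * 2)) (fib m) (fib (1 + m))))) (sym (+-suc _ _))))

  inserted-later-≥ : ∀ t m → gib r p (t * 2) * fib (1 + m) ≤ gib r p (1 + t * 2) * fib m →
    inserted r p (1 + t) m ≤ inserted r p t (2 + m)
  inserted-later-≥ t m le = ≤-by 0 le (trans (+-identityʳ _)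
    (eq (gib r p (t * 2)) (gib r p (1 + t * 2)) (fib m) (fib (1 + m))))

  inserted-rises : p < r → ∀ t j → inserted r p t (2 + j * 2) < inserted r p (1 + t) (j * 2)
  inserted-rises p<r t j = inserted-later-< t (j * 2) (gib-fib-cross-even r p p<r t j)

  inserted-rises-before-middle : p < r → ∀ t d →
    inserted r p t (3 + (t + d) * 2) < inserted r p (1 + t) (1 + (t + d) * 2)
  inserted-rises-before-middle p<r t d =
    inserted-later-< t (1 + (t + d) * 2) (gib-fib-cross-odd-< r p p<r t d)

  inserted-falls-after-middle : ∀ c e →
    inserted r p (2 + c + e) (1 + c * 2) ≤ inserted r p (1 + c + e) (3 + c * 2)
  inserted-falls-after-middle c e =
    inserted-later-≥ (1 + c + e) (1 + c * 2) (gib-fib-cross-odd-≥ r p c e)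

  -- Inserting a 0 loses exactly `gib r p (t * 2) * fib (1 + m)` against the optimal continuation of
  -- the same length.
  inserted<bound : p < r → ∀ t m →
    inserted r p t (1 + m) < bound (gib r p (1 + t * 2)) (gib r p (2 + t * 2)) (2 + m)
  inserted<bound p<r t m = ≤-by 0 (*-mono-<-≤ (gib>0 r p p<r t) ≤-refl (fib>0 m))
    (eq′ (gib r p (t * 2)) (gib r p (1 + t * 2)) (fib (1 + m)) (fib (2 + m)))
    where
    eq′ : ∀ a b f g →
      suc (b * f + (a + b + b) * g) + a * f + 0 ≡ b * g + (a + b) * (f + g) + suc (0 * f)
    eq′ = solve-∀

-- Supplies the hypothesis a < b of `inserted-7-4>`. The sequence runs 1, 0, 1, 1, 2, 3, so among
-- the pairs that start at an even index strictness begins with index 4.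
gib-1-0-rises : ∀ t → gib 1 0 (4 + t * 2) < gib 1 0 (5 + t * 2)
gib-1-0-rises zero    = ≤-refl
gib-1-0-rises (suc t) = m<n+m _ (≤-<-trans z≤n (gib-1-0-rises t))

bound-⟨10⟩ : ∀ r p t m → bound p (r + p) (t * 2 + m) ≡ bound (gib r p (1 + t * 2)) (gib r p (2 + t * 2)) m
bound-⟨10⟩ r p zero    m = refl
bound-⟨10⟩ r p (suc t) m = trans
  (cong (bound p (r + p)) (sym (trans (+-suc (t * 2) (suc m)) (cong suc (+-suc (t * 2) m)))))
  (trans (bound-⟨10⟩ r p t (2 + m)) (sym (bound-10 (gib r p (1 + t * 2)) (gib r p (2 + t * 2)) m)))

-- For the prefix 100100 the second insertion is compared with 1000 … : both sides grow at the
-- same rate in t, and the ratio 3/5 of consecutive Fibonacci numbers just decides between them.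
module _ (t : ℕ) where

  private
    a b : ℕ
    a = gib 1 0 (t * 2)
    b = gib 1 0 (1 + t * 2)

    gib-a-b : ∀ r p → gib r p (t * 2) ≡ r * a + p * b
    gib-a-b r p = gib-linear r p (t * 2)

    gib-a-b′ : ∀ r p → gib r p (1 + t * 2) ≡ r * b + p * (a + b)
    gib-a-b′ r p = gib-linear r p (1 + t * 2)

    lhs : ℕ → ℕ
    lhs m = bound (7 * b + 4 * (a + b)) (7 * a + 4 * b + (7 * b + 4 * (a + b)) + (7 * b + 4 * (a + b))) m

    rhs : ℕ → ℕ
    rhs m = bound (5 * b + 9 * (a + b)) (5 * a + 9 * b + (5 * b + 9 * (a + b))) m

    lhs-eq : ∀ m → inserted 7 4 t m ≡ lhs m
    lhs-eq m rewrite gib-a-b 7 4 | gib-a-b′ 7 4 = refl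

    rhs-eq : ∀ m → bound 9 14 (t * 2 + m) ≡ rhs m
    rhs-eq m rewrite bound-⟨10⟩ 5 9 t m | gib-a-b 5 9 | gib-a-b′ 5 9 = refl

  inserted-7-4≤ : ∀ m → 3 * fib (1 + m) ≤ 5 * fib m → inserted 7 4 t m ≤ bound 9 14 (t * 2 + m)
  -- Three times the difference of the two sides is (a + 3b)(5f - 3g) + 2f(5a - 3b).
  inserted-7-4≤ m 3g≤5f rewrite lhs-eq m | rhs-eq m = *-cancelˡ-≤ 3
    (≤-by 0 (+-mono-≤ (*-monoʳ-≤ (a + 3 * b) 3g≤5f) (*-monoʳ-≤ (2 * fib m) 3b≤5a))
      (eq a b (fib m) (fib (1 + m))))
    where
    3b≤5a : b * 3 ≤ a * 5
    -- 3 and 5 are `fib 4` and `fib 5`, so this is the cross inequality at j = 2.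
    3b≤5a = <⇒≤ (gib-fib-cross-even 1 0 z<s t 2)
    eq : ∀ a b f g →
      3 * ((7 * b + 4 * (a + b)) * f + (7 * a + 4 * b + (7 * b + 4 * (a + b)) + (7 * b + 4 * (a + b))) * g)
        + ((a + 3 * b) * (5 * f) + 2 * f * (a * 5)) + 0
      ≡ 3 * ((5 * b + 9 * (a + b)) * f + (5 * a + 9 * b + (5 * b + 9 * (a + b))) * g)
        + ((a + 3 * b) * (3 * g) + 2 * f * (b * 3))
    eq = solve-∀

  -- Length 2 is the only positive length at which 3 `fib (1 + m)` exceeds 5 `fib m`. This exception
  -- produces the isolated word `odd-O₂`.
  inserted-7-4> : a < b → bound 9 14 (t * 2 + 2) < inserted 7 4 t 2
  inserted-7-4> a<b rewrite lhs-eq 2 | rhs-eq 2 =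
    ≤-by 2 (*-monoʳ-≤ 3 a<b) (eq a b)
    where
    eq : ∀ a b →
      suc ((5 * b + 9 * (a + b)) * 1 + (5 * a + 9 * b + (5 * b + 9 * (a + b))) * 2) + 3 * b + 2
      ≡ (7 * b + 4 * (a + b)) * 1 + (7 * a + 4 * b + (7 * b + 4 * (a + b)) + (7 * b + 4 * (a + b))) * 2
        + 3 * suc a
    eq = solve-∀

  -- The word (10)ᵗ 00 d, which is not bounded by inserted-7-4≤ because 3 fib 3 > 5 fib 2.
  00-7-4≤ : bound (gib 7 4 (1 + t * 2)) (gib 7 4 (2 + t * 2) + gib 7 4 (1 + t * 2) + gib 7 4 (1 + t * 2)) 1
            ≤ bound 9 14 (t * 2 + 2)
  00-7-4≤ rewrite rhs-eq 2 | gib-a-b 7 4 | gib-a-b′ 7 4 = ≤-by (14 * a + 12 * b) ≤-refl (eq a b)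
    where
    eq : ∀ a b →
      (7 * b + 4 * (a + b)) * 1 + (7 * a + 4 * b + (7 * b + 4 * (a + b)) + (7 * b + 4 * (a + b)) + (7 * b + 4 * (a + b))) * 1 + 0 + (14 * a + 12 * b)
      ≡ (5 * b + 9 * (a + b)) * 1 + (5 * a + 9 * b + (5 * b + 9 * (a + b))) * 2 + 0
    eq = solve-∀

-- The condition p/q ≤ 5/8 survives both `10` and `0`. The fraction 5/8 lies slightly above the
-- inverse of the golden ratio, the fixed point of the action of `10` on p/q.
ratio-10 : ∀ p q → 8 * p ≤ 5 * q → 8 * (p + q) ≤ 5 * (q + (p + q))
ratio-10 p q 8p≤5q = *-cancelˡ-≤ 5 (≤-by p (*-monoʳ-≤ 2 8p≤5q) (eq p q))
  where
  eq : ∀ p q → 5 * (8 * (p + q)) + 2 * (5 * q) + p ≡ 5 * (5 * (q + (p + q))) + 2 * (8 * p)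
  eq = solve-∀

ratio-0 : ∀ p q → 8 * p ≤ 5 * q → 8 * p ≤ 5 * (q + p)
ratio-0 p q 8p≤5q = ≤-trans 8p≤5q (*-monoʳ-≤ 5 (m≤m+n q p))

-- With f, g the consecutive Fibonacci numbers involved, the quotient of the two bounds is 1 +
-- 1/(f/g + q/p). It is largest at g = 2f and p : q = 5 : 8, where it equals 31/21.
bound-insertion≤ : ∀ p q → 8 * p ≤ 5 * q → ∀ m → 21 * bound p (q + p) (1 + m) ≤ 31 * bound p q (1 + m)
bound-insertion≤ p q 8p≤5q m =
  ≤-by 0 (+-mono-≤ (*-monoʳ-≤ (5 * p) (fib≤2fib m)) (*-monoʳ-≤ (2 * fib (2 + m)) 8p≤5q))
    (eq p q (fib (1 + m)) (fib (2 + m)))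
  where
  eq : ∀ p q f g →
    21 * (p * f + (q + p) * g) + (5 * p * (2 * f) + 2 * g * (5 * q)) + 0
    ≡ 31 * (p * f + q * g) + (5 * p * g + 2 * g * (8 * p))
  eq = solve-∀

-- Stern values of words

fromDigits-∷ʳ : ∀ (ds : Word) d → fromDigits (ds ++ [ d ]) ≡ toℕ d * 2 ^ length ds + fromDigits ds
fromDigits-∷ʳ []       d = eq (toℕ d)
  where
  eq : ∀ x → x + 0 ≡ x * 1 + 0
  eq = solve-∀
fromDigits-∷ʳ (e ∷ ds) d =
  trans (cong (λ x → toℕ e + x * 2) (fromDigits-∷ʳ ds d))
        (eq (toℕ e) (toℕ d) (2 ^ length ds) (fromDigits ds))
  where
  eq : ∀ e d n x → e + (d * n + x) * 2 ≡ d * (2 * n) + (e + x * 2)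
  eq = solve-∀

value-∷ : ∀ d w → value (d ∷ w) ≡ toℕ d * 2 ^ length w + value w
value-∷ d w rewrite unfold-reverse d w | fromDigits-∷ʳ (reverse w) d | length-reverse w = refl

value-0∷ : ∀ w → value (0b ∷ w) ≡ value w
value-0∷ = value-∷ 0b

value-1∷ : ∀ w → value (1b ∷ w) ≡ 2 ^ length w + value w
value-1∷ w = trans (value-∷ 1b w) (cong (_+ value w) (+-identityʳ _))

value<2^length : ∀ w → value w < 2 ^ length w
value<2^length []             = z<s
value<2^length (zero ∷ w)     rewrite value-0∷ w = <-≤-trans (value<2^length w) (m≤m+n _ _)
value<2^length (suc zero ∷ w) rewrite value-1∷ w | +-identityʳ (2 ^ length w) =
  +-monoʳ-< (2 ^ length w) (value<2^length w)

toWord : ∀ m v → v < 2 ^ m → ∃ λ w → length w ≡ m × value w ≡ v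
toWord zero    zero    v<1 = [] , refl , refl
toWord zero    (suc v) (s≤s ())
toWord (suc m) v v<2^m with v <? 2 ^ m
... | yes v< with toWord m v v<
...   | w , |w|≡m , w≡v = 0b ∷ w , cong suc |w|≡m , trans (value-0∷ w) w≡v
toWord (suc m) v v<2^m | no v≮ with toWord m (v ∸ 2 ^ m) (+-cancelˡ-< (2 ^ m) _ _
  (subst (_< 2 ^ m + 2 ^ m) (sym (m+[n∸m]≡n (≮⇒≥ v≮))) (subst (v <_) (cong (2 ^ m +_) (+-identityʳ _)) v<2^m)))
...   | w , refl , w≡v = 1b ∷ w , refl ,
  trans (value-1∷ w) (trans (cong (2 ^ length w +_) w≡v) (m+[n∸m]≡n (≮⇒≥ v≮)))

-- Lexicographic order between words of equal length. After the first difference the remaining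
-- digits cannot change the order of the values, so `here` only asks for equal lengths.
data _≺_ : Word → Word → Set where
  here  : ∀ {x y} → length x ≡ length y → (0b ∷ x) ≺ (1b ∷ y)
  there : ∀ d {x y} → x ≺ y → (d ∷ x) ≺ (d ∷ y)

infix 4 _≺_

≺-length : ∀ {x y} → x ≺ y → length x ≡ length y
≺-length (here eq)    = cong suc eq
≺-length (there d lt) = cong suc (≺-length lt)

++-≺ : ∀ u {x y} → x ≺ y → u ++ x ≺ u ++ y
++-≺ []      lt = lt
++-≺ (d ∷ u) lt = there d (++-≺ u lt)

≺⇒value< : ∀ {x y} → x ≺ y → value x < value y
≺⇒value< (here {x} {y} eq) rewrite value-0∷ x | value-1∷ y | sym eq =
  <-≤-trans (value<2^length x) (m≤m+n _ _)
≺⇒value< (there d {x} {y} lt) rewrite value-∷ d x | value-∷ d y | ≺-length lt =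
  +-monoʳ-< (toℕ d * 2 ^ length y) (≺⇒value< lt)

-- The Stern value of the number whose expansion is that of X followed by w, where
-- p = stern X and q = stern (1 + X).
eval : ℕ → ℕ → Word → ℕ
eval p q []             = p
eval p q (zero ∷ w)     = eval p (q + p) w
eval p q (suc zero ∷ w) = eval (p + q) q w

⟦_⟧ : Word → ℕ
⟦_⟧ = eval 0 1

-- The leading digit of w is absorbed into X, which becomes 2X or 1 + 2X; the defining equations of
-- `stern` then give the new pair.
stern-++ : ∀ X w → stern (X * 2 ^ length w + value w) ≡ eval (stern X) (stern (1 + X)) w
stern-++ X []         = cong stern (trans (+-identityʳ _) (*-identityʳ X))
stern-++ X (zero ∷ w) = begin
  stern (X * (2 * 2 ^ length w) + value (0b ∷ w))          ≡⟨ cong (λ v → stern (X * (2 * 2 ^ length w) + v)) (value-0∷ w) ⟩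
  stern (X * (2 * 2 ^ length w) + value w)                 ≡⟨ cong stern (eq X (2 ^ length w) (value w)) ⟩
  stern (2 * X * 2 ^ length w + value w)                   ≡⟨ stern-++ (2 * X) w ⟩
  eval (stern (2 * X)) (stern (1 + 2 * X)) w               ≡⟨ cong₂ (λ p q → eval p q w) (stern-even X) (trans (stern-odd X) (+-comm (stern X) _)) ⟩
  eval (stern X) (stern (1 + X) + stern X) w               ∎
  where
  open ≡-Reasoning
  eq : ∀ x m v → x * (2 * m) + v ≡ 2 * x * m + v
  eq = solve-∀
stern-++ X (suc zero ∷ w) = begin
  stern (X * (2 * 2 ^ length w) + value (1b ∷ w))          ≡⟨ cong (λ v → stern (X * (2 * 2 ^ length w) + v)) (value-1∷ w) ⟩
  stern (X * (2 * 2 ^ length w) + (2 ^ length w + value w)) ≡⟨ cong stern (eq X (2 ^ length w) (value w)) ⟩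
  stern (suc (2 * X) * 2 ^ length w + value w)             ≡⟨ stern-++ (suc (2 * X)) w ⟩
  eval (stern (1 + 2 * X)) (stern (2 + 2 * X)) w           ≡⟨ cong₂ (λ p q → eval p q w) (stern-odd X) (trans (cong stern (eq′ X)) (stern-even (1 + X))) ⟩
  eval (stern X + stern (1 + X)) (stern (1 + X)) w         ∎
  where
  open ≡-Reasoning
  eq : ∀ x m v → x * (2 * m) + (m + v) ≡ suc (2 * x) * m + v
  eq = solve-∀
  eq′ : ∀ x → 2 + 2 * x ≡ 2 * (1 + x)
  eq′ = solve-∀

stern-value : ∀ w → stern (value w) ≡ ⟦ w ⟧
stern-value w = stern-++ 0 w

eval-⟨10⟩ : ∀ r p t i w →
  eval (gib r p (1 + i * 2)) (gib r p (2 + i * 2)) (⟨10⟩^ t ++ w)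
  ≡ eval (gib r p (1 + (t + i) * 2)) (gib r p (2 + (t + i) * 2)) w
eval-⟨10⟩ r p zero    i w = refl
eval-⟨10⟩ r p (suc t) i w =
  trans (eval-⟨10⟩ r p t (suc i) w) (cong (λ j → eval (gib r p (1 + j * 2)) (gib r p (2 + j * 2)) w) (+-suc t i))

eval-⟨10⟩₀ : ∀ r p t w →
  eval p (r + p) (⟨10⟩^ t ++ w) ≡ eval (gib r p (1 + t * 2)) (gib r p (2 + t * 2)) w
eval-⟨10⟩₀ r p t w = trans (eval-⟨10⟩ r p t 0 w)
  (cong (λ j → eval (gib r p (1 + j * 2)) (gib r p (2 + j * 2)) w) (+-identityʳ t))

-- The upper bound for words of given length

bound-swap : ∀ {p q} → p ≤ q → ∀ m → bound q p m ≤ bound p q m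
bound-swap {p} {q} p≤q m with m≤n⇒∃[o]m+o≡n p≤q
... | d , refl = ≤-by 0 (*-monoʳ-≤ d (fib-mono m)) (eq p d (fib m) (fib (1 + m)))
  where
  eq : ∀ p d f g → (p + d) * f + p * g + d * g + 0 ≡ p * f + (p + d) * g + d * f
  eq = solve-∀

-- Reading a 1 yields the pair (p + q , q), which leaves the region p ≤ q. The induction therefore
-- runs over all pairs, with the disjunction in the role of a maximum of the two orders.
eval≤bound⊎ : ∀ p q w → eval p q w ≤ bound p q (length w) ⊎ eval p q w ≤ bound q p (length w)
eval≤bound⊎ p q []         = inj₂ (≤-by 0 z≤n (eq p q))
  where
  eq : ∀ p q → p + 0 + 0 ≡ q * 0 + p * 1 + 0
  eq = solve-∀
eval≤bound⊎ p q (zero ∷ w) = inj₂ (≤-trans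
  ([ (λ le → le) , (λ le → ≤-trans le (bound-swap (m≤n+m p q) (length w))) ]′ (eval≤bound⊎ p (q + p) w))
  (≤-by 0 z≤n (eq p q (fib (length w)) (fib (1 + length w)))))
  where
  eq : ∀ p q f g → p * f + (q + p) * g + 0 + 0 ≡ q * g + p * (f + g) + 0
  eq = solve-∀
eval≤bound⊎ p q (suc zero ∷ w) = inj₁ (≤-trans
  ([ (λ le → ≤-trans le (bound-swap (m≤n+m q p) (length w))) , (λ le → le) ]′ (eval≤bound⊎ (p + q) q w))
  (≤-by 0 z≤n (eq p q (fib (length w)) (fib (1 + length w)))))
  where
  eq : ∀ p q f g → q * f + (p + q) * g + 0 + 0 ≡ p * g + q * (f + g) + 0
  eq = solve-∀

eval≤bound : ∀ {p q} → p ≤ q → ∀ w → eval p q w ≤ bound p q (length w)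
eval≤bound {p} {q} p≤q w with eval≤bound⊎ p q w
... | inj₁ le = le
... | inj₂ le = ≤-trans le (bound-swap p≤q (length w))

-- Optimal words and the comparison with them

opt : ℕ → Word
opt zero                = []
opt (suc zero)          = 1b ∷ []
opt (suc (suc zero))    = 1b ∷ 1b ∷ []
opt (suc (suc (suc m))) = 1b ∷ 0b ∷ opt (suc m)

length-opt : ∀ m → length (opt m) ≡ m
length-opt zero                = refl
length-opt (suc zero)          = refl
length-opt (suc (suc zero))    = refl
length-opt (suc (suc (suc m))) = cong (2 +_) (length-opt (suc m))

opt-odd : ∀ j → opt (1 + j * 2) ≡ ⟨10⟩^ j ++ 1b ∷ []
opt-odd zero    = refl
opt-odd (suc j) = cong (λ w → 1b ∷ 0b ∷ w) (opt-odd j)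

opt-even : ∀ j → opt (2 + j * 2) ≡ ⟨10⟩^ j ++ 1b ∷ 1b ∷ []
opt-even zero    = refl
opt-even (suc j) = cong (λ w → 1b ∷ 0b ∷ w) (opt-even j)

-- The empty word has value p while `bound p q 0` is q; hence the lengths `1 + m` here and in later
-- uses.
eval-opt : ∀ p q m → eval p q (opt (1 + m)) ≡ bound p q (1 + m)
eval-opt p q zero          = eq p q
  where
  eq : ∀ p q → p + q ≡ p * 1 + q * 1
  eq = solve-∀
eval-opt p q (suc zero)    = eq p q
  where
  eq : ∀ p q → p + q + q ≡ p * 1 + q * 2
  eq = solve-∀
eval-opt p q (suc (suc m)) = trans (eval-opt (p + q) (q + (p + q)) m) (bound-10 p q (1 + m))

data EndsIn0 : Word → Set where
  last0 : EndsIn0 (0b ∷ [])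
  _∷_   : ∀ d {w} → EndsIn0 w → EndsIn0 (d ∷ w)

++-EndsIn0 : ∀ u {w} → EndsIn0 w → EndsIn0 (u ++ w)
++-EndsIn0 []      e = e
++-EndsIn0 (d ∷ u) e = d ∷ ++-EndsIn0 u e

-- Cases by the first departure from the optimal word. A 0 in place of a 1 either opens a block `10`
-- of that word, or is the last digit and falls under `ends0`. In `before` the tail z is nonempty
-- and can be classified again.
data AgainstOpt : Word → Set where
  before : ∀ t m z → length z ≡ suc m → AgainstOpt (⟨10⟩^ t ++ 0b ∷ z)
  ends0  : ∀ {w} → EndsIn0 w → AgainstOpt w
  equal  : ∀ m → AgainstOpt (opt (1 + m))
  after  : ∀ {w} m → length w ≡ 1 + m → opt (1 + m) ≺ w → AgainstOpt w

againstOpt : ∀ d w → AgainstOpt (d ∷ w)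
againstOpt zero       []                    = ends0 last0
againstOpt zero       (d ∷ w)               = before 0 (length w) (d ∷ w) refl
againstOpt (suc zero) []                    = equal 0
againstOpt (suc zero) (zero ∷ [])           = ends0 (1b ∷ last0)
againstOpt (suc zero) (suc zero ∷ [])       = equal 1
againstOpt (suc zero) (suc zero ∷ d ∷ w)    =
  after (2 + length w) refl (there 1b (here (length-opt (suc (length w)))))
againstOpt (suc zero) (zero ∷ d ∷ w) with d ∷ w | againstOpt d w
... | .(⟨10⟩^ t ++ 0b ∷ z) | before t m z eq = before (suc t) m z eq
... | _                    | ends0 e         = ends0 (1b ∷ 0b ∷ e)
... | .(opt (1 + m))       | equal m         = equal (2 + m)
... | _                    | after m eq lt   = after (2 + m) (cong (2 +_) eq) (there 1b (there 0b lt))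

-- Domination by a smaller number

Dominated : ℕ → Set
Dominated v = ∃ λ j → j < v × stern v ≤ stern j

dominated : ∀ {x y} → x ≺ y → ⟦ y ⟧ ≤ ⟦ x ⟧ → Dominated (value y)
dominated {x} {y} x≺y le =
  value x , ≺⇒value< x≺y , subst₂ _≤_ (sym (stern-value y)) (sym (stern-value x)) le

dominated-even : ∀ {w} → EndsIn0 (1b ∷ w) → Dominated (value (1b ∷ w))
dominated-even {w} e with halve e
  where
  halve : ∀ {w} → EndsIn0 w → ∃ λ x → value w ≡ 2 * x
  halve last0   = 0 , refl
  halve (_∷_ d {zero ∷ []} e) = toℕ d , trans (value-∷ d (0b ∷ [])) (eq (toℕ d))
    where
    eq : ∀ x → x * 2 + 0 ≡ 2 * x
    eq = solve-∀
  halve (_∷_ d {suc zero ∷ []} (.(suc zero) ∷ ()))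
  halve (_∷_ d {d′ ∷ d″ ∷ w} e) with halve e
  ... | x , w≡2x = toℕ d * 2 ^ length (d″ ∷ w) + x ,
    trans (value-∷ d (d′ ∷ d″ ∷ w)) (trans (cong (toℕ d * 2 ^ length (d′ ∷ d″ ∷ w) +_) w≡2x)
      (eq (toℕ d) (2 ^ length (d″ ∷ w)) x))
    where
    eq : ∀ d n x → d * (2 * n) + 2 * x ≡ 2 * (d * n + x)
    eq = solve-∀
-- Zero is not smaller than itself; the leading 1 excludes it.
... | zero  , eq = ⊥-elim (<-irrefl (sym eq) (subst (0 <_) (sym (value-1∷ w)) (<-≤-trans (m^n>0 2 (length w)) (m≤m+n _ _))))
... | suc x , eq = suc x , subst (suc x <_) (sym eq) (m<m+n (suc x) z<s) ,
  ≤-reflexive (trans (cong stern eq) (stern-even (suc x)))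

-- Inserting a 0 into an optimal word costs a factor of at most 31/21 relative to the optimal
-- word with one letter less, and hence (31/21)² for two insertions.
eval-one-insertion : ∀ p q → 8 * p ≤ 5 * q → ∀ t m z → length z ≡ 1 + m →
  21 * eval p q (⟨10⟩^ t ++ 0b ∷ z) ≤ 31 * bound p q (t * 2 + (1 + m))
eval-one-insertion p q 8p≤5q zero m z eq = begin
  21 * eval p (q + p) z            ≤⟨ *-monoʳ-≤ 21 (eval≤bound (m≤n+m p q) z) ⟩
  21 * bound p (q + p) (length z)  ≡⟨ cong (λ l → 21 * bound p (q + p) l) eq ⟩
  21 * bound p (q + p) (1 + m)     ≤⟨ bound-insertion≤ p q 8p≤5q m ⟩
  31 * bound p q (1 + m)           ∎
  where open ≤-Reasoning
eval-one-insertion p q 8p≤5q (suc t) m z eq =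
  subst (λ b → 21 * eval (p + q) (q + (p + q)) (⟨10⟩^ t ++ 0b ∷ z) ≤ 31 * b)
        (bound-10 p q (t * 2 + (1 + m))) (eval-one-insertion (p + q) (q + (p + q)) (ratio-10 p q 8p≤5q) t m z eq)

eval-two-insertions : ∀ p q → 8 * p ≤ 5 * q → ∀ s t m z → length z ≡ 1 + m →
  21 * (21 * eval p q (⟨10⟩^ s ++ 0b ∷ ⟨10⟩^ t ++ 0b ∷ z)) ≤ 31 * (31 * bound p q (s * 2 + (t * 2 + (1 + m))))
eval-two-insertions p q 8p≤5q zero t m z eq = begin
  21 * (21 * e)                            ≤⟨ *-monoʳ-≤ 21 (eval-one-insertion p (q + p) (ratio-0 p q 8p≤5q) t m z eq) ⟩
  21 * (31 * bound p (q + p) N)            ≡⟨ x∙yz≈y∙xz *-commutativeSemigroup 21 31 (bound p (q + p) N) ⟩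
  31 * (21 * bound p (q + p) N)            ≤⟨ *-monoʳ-≤ 31 (subst (λ l → 21 * bound p (q + p) l ≤ 31 * bound p q l)
                                                (sym (+-suc (t * 2) m)) (bound-insertion≤ p q 8p≤5q (t * 2 + m))) ⟩
  31 * (31 * bound p q N)                  ∎
  where
  open ≤-Reasoning
  N = t * 2 + (1 + m)
  e = eval p (q + p) (⟨10⟩^ t ++ 0b ∷ z)
eval-two-insertions p q 8p≤5q (suc s) t m z eq =
  subst (λ b → 21 * (21 * eval (p + q) (q + (p + q)) (⟨10⟩^ s ++ 0b ∷ ⟨10⟩^ t ++ 0b ∷ z)) ≤ 31 * (31 * b))
        (bound-10 p q (s * 2 + (t * 2 + (1 + m)))) (eval-two-insertions (p + q) (q + (p + q)) (ratio-10 p q 8p≤5q) s t m z eq)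

-- Ascending lists of words and records

_⊏_ : Word → Word → Set
x ⊏ y = x ≺ y × ⟦ x ⟧ < ⟦ y ⟧

infix 4 _⊏_

-- The first and last words are indices, so that joining two lists needs only one comparison at the
-- seam.
data Ascending : Word → List Word → Word → Set where
  [-] : ∀ {x} → Ascending x [ x ] x
  _∷_ : ∀ {x y ws z} → x ⊏ y → Ascending y ws z → Ascending x (x ∷ ws) z

Ascending-++ : ∀ {a xs b c ys d} → Ascending a xs b → b ⊏ c → Ascending c ys d → Ascending a (xs ++ ys) d
Ascending-++ [-]        b⊏c ys = b⊏c ∷ ys
Ascending-++ (x⊏y ∷ xs) b⊏c ys = x⊏y ∷ Ascending-++ xs b⊏c ys

Ascending-applyUpTo : ∀ (f : ℕ → Word) n → (∀ i → i < n → f i ⊏ f (suc i)) →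
  Ascending (f 0) (applyUpTo f (suc n)) (f n)
Ascending-applyUpTo f zero    step = [-]
Ascending-applyUpTo f (suc n) step =
  step 0 z<s ∷ Ascending-applyUpTo (λ i → f (suc i)) n (λ i i<n → step (suc i) (s≤s i<n))

Ascending⇒Linked : ∀ {a ws b} → Ascending a ws b → Linked _<_ (map value ws)
Ascending⇒Linked [-]                         = [-]
Ascending⇒Linked ((x≺y , _) ∷ [-])           = ≺⇒value< x≺y ∷ [-]
Ascending⇒Linked ((x≺y , _) ∷ rest@(_ ∷ _))  = ≺⇒value< x≺y ∷ Ascending⇒Linked rest

head-least : ∀ {a ws b y} → Ascending a ws b → y ∈ ws →
  length a ≡ length y × value a ≤ value y × ⟦ a ⟧ ≤ ⟦ y ⟧
head-least [-]             (here refl) = refl , ≤-refl , ≤-refl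
head-least (_ ∷ _)         (here refl) = refl , ≤-refl , ≤-refl
head-least ((x≺y , x<y) ∷ ws) (there y∈) with head-least ws y∈
... | l , v , e = trans (≺-length x≺y) l , ≤-trans (<⇒≤ (≺⇒value< x≺y)) v , ≤-trans (<⇒≤ x<y) e

Ascending-stern : ∀ {a ws b x y} → Ascending a ws b → x ∈ ws → y ∈ ws → value x < value y → ⟦ x ⟧ < ⟦ y ⟧
Ascending-stern [-]              (here refl) (here refl) x<y = ⊥-elim (<-irrefl refl x<y)
Ascending-stern (_ ∷ _)          (here refl) (here refl) x<y = ⊥-elim (<-irrefl refl x<y)
Ascending-stern ((_ , lt) ∷ ws)  (here refl) (there y∈)  x<y = <-≤-trans lt (proj₂ (proj₂ (head-least ws y∈)))
Ascending-stern ((a≺ , _) ∷ ws)  (there x∈)  (here refl) x<y =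
  ⊥-elim (<-asym x<y (<-≤-trans (≺⇒value< a≺) (proj₁ (proj₂ (head-least ws x∈)))))
Ascending-stern (_ ∷ ws)         (there x∈)  (there y∈)  x<y = Ascending-stern ws x∈ y∈ x<y

-- Leading zeros leave the pair (0 , 1) fixed, so words of length k cover all numbers below 2ᵏ, and
-- `bound 0 1 k` is the Fibonacci number.
stern≤fib : ∀ k {i} → i < 2 ^ k → stern i ≤ fib (1 + k)
stern≤fib k i<2^k with toWord k _ i<2^k
... | w , refl , refl = subst₂ _≤_ (sym (stern-value w)) (+-identityʳ _) (eval≤bound z≤n w)

toBinary : ∀ k {v} → 2 ^ k ≤ v → v < 2 ^ suc k → ∃ λ w → length w ≡ k × value (1b ∷ w) ≡ v
toBinary k 2^k≤v v< with toWord (suc k) _ v<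
... | zero ∷ w     , refl , refl =
  ⊥-elim (<⇒≱ (value<2^length w) (subst (2 ^ k ≤_) (value-0∷ w) 2^k≤v))
... | suc zero ∷ w , refl , refl = w , refl , refl

module _ (k : ℕ) {h ws l} (ascending : Ascending (1b ∷ h) ws l) (|h|≡k : length h ≡ k)
         (beyond : fib (1 + k) < ⟦ 1b ∷ h ⟧)
         (classify : ∀ w → length w ≡ k → (1b ∷ w) ∈ ws ⊎ Dominated (value (1b ∷ w))) where

  private
    -- Well-founded induction on i: a dominated i is replaced by a smaller number at least as good,
    -- until a listed word is reached, where the list is ascending, or a number below 2ᵏ, which
    -- `beyond` handles.
    stern< : ∀ {w} → w ∈ ws → value w < 2 ^ suc k → ∀ i → i < value w → stern i < stern (value w)
    stern< {w} w∈ w< = <-rec _ go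
      where
      go : ∀ i → (∀ {j} → j < i → j < value w → stern j < stern (value w)) → i < value w → stern i < stern (value w)
      go i rec i<w with i <? 2 ^ k
      ... | yes i<2^k rewrite stern-value w =
        ≤-<-trans (stern≤fib k i<2^k) (<-≤-trans beyond (proj₂ (proj₂ (head-least ascending w∈))))
      ... | no i≮2^k with toBinary k (≮⇒≥ i≮2^k) (<-trans i<w w<)
      ...   | x , |x|≡k , refl with classify x |x|≡k
      ...     | inj₁ x∈             = subst₂ _<_ (sym (stern-value (1b ∷ x))) (sym (stern-value w)) (Ascending-stern ascending x∈ w∈ i<w)
      ...     | inj₂ (j , j<i , le) = ≤-<-trans le (rec j<i (<-trans j<i i<w))

  recordSettersInOrder : KBitRecordSettersInOrder (suc k) (map value ws)
  recordSettersInOrder = Ascending⇒Linked ascending , λ v → mk⇔ (to v) (from v)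
    where
    to : ∀ v → v ∈ map value ws → KBitRecordSetter (suc k) v
    to v v∈ with ∈-map⁻ value v∈
    ... | w , w∈ , refl with head-least ascending w∈
    ...   | |h|≡|w| , h≤w , _ =
      ≤-trans (subst₂ _≤_ (cong (2 ^_) |h|≡k) (sym (value-1∷ h)) (m≤m+n _ _)) h≤w
      , w<
      , λ {i} → stern< w∈ w< i
      where
      w< : value w < 2 ^ suc k
      w< = subst (λ n → value w < 2 ^ n) (trans (sym |h|≡|w|) (cong suc |h|≡k)) (value<2^length w)

    from : ∀ v → KBitRecordSetter (suc k) v → v ∈ map value ws
    from v (2^k≤v , v< , record-v) with toBinary k 2^k≤v v<
    ... | w , |w|≡k , refl with classify w |w|≡k
    ...   | inj₁ w∈             = ∈-map⁺ value w∈
    ...   | inj₂ (j , j<v , le) = ⊥-elim (<⇒≱ (record-v j<v) le)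

-- Two duplicate-free lists with the same members are permutations of each other.
number≡length : ∀ k vs → KBitRecordSettersInOrder k vs → numberOfKBitRecordSetters k ≡ length vs
number≡length k vs (linked , iff) = ↭-length (∼bag⇒↭ (unique∧set⇒bag
  (filter⁺ (kBitRecordSetter? k) (upTo⁺ (2 ^ k)))
  (AllPairs.map <⇒≢ (Linked⇒AllPairs <-trans linked))
  (λ {v} → mk⇔
    (λ v∈ → Equivalence.from (iff v) (proj₂ (∈-filter⁻ (kBitRecordSetter? k) {xs = upTo (2 ^ k)} v∈)))
    (λ v∈ → let kbit = Equivalence.to (iff v) v∈ in
            ∈-filter⁺ (kBitRecordSetter? k) (∈-upTo⁺ (proj₁ (proj₂ kbit))) kbit))))

-- Small k by computation

-- Depth-first traversal of the binary expansions that begin with X, in increasing order, carrying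
-- the pair (`stern X` , `stern (1 + X)`) and the running maximum M. Each Stern value thus costs
-- only additions.
scan : ℕ → ℕ → ℕ → ℕ → ℕ → List ℕ × ℕ
scan zero    X p q M with M <ᵇ p
... | true  = [ X ] , p
... | false = [] , M
scan (suc m) X p q M =
  let l , M′ = scan m (2 * X) p (q + p) M ; r , M″ = scan m (1 + 2 * X) (p + q) q M′ in l ++ r , M″

-- Attainment matters: a leaf with value at most M fails to be a record-setter because of the j that
-- attains M.
IsMaxBelow : ℕ → ℕ → Set
IsMaxBelow x M = (∀ {j} → j < x → stern j ≤ M) × (∃ λ j → j < x × stern j ≡ M)

RecordsBetween : ℕ → ℕ → List ℕ → Set
RecordsBetween lo hi vs = ∀ v → v ∈ vs ⇔ (lo ≤ v × v < hi × RecordSetter v)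

RecordsBetween-++ : ∀ {lo mid hi xs ys} → lo ≤ mid → mid ≤ hi →
  RecordsBetween lo mid xs → RecordsBetween mid hi ys → RecordsBetween lo hi (xs ++ ys)
RecordsBetween-++ {lo} {mid} {hi} {xs} {ys} lo≤mid mid≤hi isXs isYs v = mk⇔ to from
  where
  to : v ∈ xs ++ ys → lo ≤ v × v < hi × RecordSetter v
  to v∈ with ∈-++⁻ xs v∈
  ... | inj₁ v∈xs = let a , b , c = Equivalence.to (isXs v) v∈xs in a , <-≤-trans b mid≤hi , λ {i} → c {i}
  ... | inj₂ v∈ys = let a , b , c = Equivalence.to (isYs v) v∈ys in ≤-trans lo≤mid a , b , λ {i} → c {i}
  from : lo ≤ v × v < hi × RecordSetter v → v ∈ xs ++ ys
  from (lo≤v , v<hi , rec) with v <? mid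
  ... | yes v<mid = ∈-++⁺ˡ (Equivalence.from (isXs v) (lo≤v , v<mid , rec))
  ... | no  v≮mid = ∈-++⁺ʳ xs (Equivalence.from (isYs v) (≮⇒≥ v≮mid , v<hi , rec))

scan-spec : ∀ m X p q M → stern X ≡ p → stern (1 + X) ≡ q → IsMaxBelow (X * 2 ^ m) M →
  IsMaxBelow ((1 + X) * 2 ^ m) (proj₂ (scan m X p q M))
  × RecordsBetween (X * 2 ^ m) ((1 + X) * 2 ^ m) (proj₁ (scan m X p q M))
scan-spec zero X p q M refl sq (below , j , j< , sj) rewrite *-identityʳ X with M <ᵇ stern X in eq
... | true  = (below′ , X , ≤-refl , refl) , λ v → mk⇔
    (λ { (here refl) → ≤-refl , ≤-refl , λ i<X → ≤-<-trans (below i<X) M<X })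
    (λ { (X≤v , s≤s v≤X , _) → here (≤-antisym v≤X X≤v) })
  where
  M<X : M < stern X
  M<X = <ᵇ⇒< M _ (subst T (sym eq) _)
  below′ : ∀ {i} → i < suc X → stern i ≤ stern X
  below′ (s≤s i≤X) with m≤n⇒m<n∨m≡n i≤X
  ... | inj₁ i<X  = <⇒≤ (≤-<-trans (below i<X) M<X)
  ... | inj₂ refl = ≤-refl
... | false = (below′ , j , m<n⇒m<1+n j< , sj) , λ v → mk⇔
    (λ ())
    (λ { (X≤v , s≤s v≤X , rec) → ⊥-elim (contra v (≤-antisym v≤X X≤v) (λ {i} → rec {i})) })
  where
  X≤M : stern X ≤ M
  X≤M = ≮⇒≥ (λ M<X → subst T eq (<⇒<ᵇ M<X))
  contra : ∀ v → v ≡ X → RecordSetter v → _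
  contra v refl rec = <⇒≱ (rec j<) (subst (stern X ≤_) (sym sj) X≤M)
  below′ : ∀ {i} → i < suc X → stern i ≤ M
  below′ (s≤s i≤X) with m≤n⇒m<n∨m≡n i≤X
  ... | inj₁ i<X  = below i<X
  ... | inj₂ refl = X≤M
scan-spec (suc m) X p q M refl refl max
  with scan m (2 * X) p (q + p) M
     | scan-spec m (2 * X) p (q + p) M (stern-even X) (trans (stern-odd X) (+-comm p q))
         (subst (λ x → IsMaxBelow x M) (lo X (2 ^ m)) max)
  where
  lo : ∀ x n → x * (2 * n) ≡ 2 * x * n
  lo = solve-∀
... | l , M′ | max′ , isL
  with scan m (1 + 2 * X) (p + q) q M′
     | scan-spec m (1 + 2 * X) (p + q) q M′ (stern-odd X) (trans (cong stern (eq X)) (stern-even (1 + X))) max′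
  where
  eq : ∀ x → 2 + 2 * x ≡ 2 * (1 + x)
  eq = solve-∀
... | r , M″ | max″ , isR = subst (λ x → IsMaxBelow x M″) (hi X (2 ^ m)) max″
  , subst₂ (λ x y → RecordsBetween x y (l ++ r)) (sym (lo X (2 ^ m))) (hi X (2 ^ m))
      (RecordsBetween-++ (m≤n+m _ (2 ^ m)) (m≤n+m _ (2 ^ m)) isL isR)
  where
  lo : ∀ x n → x * (2 * n) ≡ 2 * x * n
  lo = solve-∀
  hi : ∀ x n → (2 + 2 * x) * n ≡ (1 + x) * (2 * n)
  hi = solve-∀

maxBelow2^ : ℕ → ℕ
scanned : ℕ → List ℕ × ℕ

maxBelow2^ zero    = 0
maxBelow2^ (suc k) = proj₂ (scanned k)

-- The numbers of k + 1 bits lie at depth k below X = 1, whose pair is (`stern 1` , `stern 2`) = (1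
-- , 1).
scanned k = scan k 1 1 1 (maxBelow2^ k)

isMaxBelow2^ : ∀ k → IsMaxBelow (2 ^ k) (maxBelow2^ k)
scanned-spec : ∀ k → IsMaxBelow (2 * 2 ^ k) (proj₂ (scanned k)) × RecordsBetween (1 * 2 ^ k) (2 * 2 ^ k) (proj₁ (scanned k))

isMaxBelow2^ zero    = (λ { (s≤s z≤n) → z≤n }) , 0 , z<s , refl
isMaxBelow2^ (suc k) = proj₁ (scanned-spec k)

scanned-spec k = scan-spec k 1 1 1 (maxBelow2^ k) refl refl
  (subst (λ x → IsMaxBelow x (maxBelow2^ k)) (sym (*-identityˡ (2 ^ k))) (isMaxBelow2^ k))

scanned-inOrder : ∀ k → Linked _<_ (proj₁ (scanned k)) → KBitRecordSettersInOrder (suc k) (proj₁ (scanned k))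
scanned-inOrder k linked = linked ,
  subst (λ x → RecordsBetween x (2 * 2 ^ k) (proj₁ (scanned k))) (*-identityˡ (2 ^ k)) (proj₂ (scanned-spec k))

-- Dominated words

length-⟨10⟩ : ∀ t w → length (⟨10⟩^ t ++ w) ≡ t * 2 + length w
length-⟨10⟩ zero    w = refl
length-⟨10⟩ (suc t) w = cong (2 +_) (length-⟨10⟩ t w)

⟨10⟩-+ : ∀ s t w → ⟨10⟩^ (s + t) ++ w ≡ ⟨10⟩^ s ++ ⟨10⟩^ t ++ w
⟨10⟩-+ zero    t w = refl
⟨10⟩-+ (suc s) t w = cong (λ x → 1b ∷ 0b ∷ x) (⟨10⟩-+ s t w)

⟨10⟩-suc : ∀ t w → ⟨10⟩^ (suc t) ++ w ≡ ⟨10⟩^ t ++ 1b ∷ 0b ∷ w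
⟨10⟩-suc t w = trans (cong (λ s → ⟨10⟩^ s ++ w) (+-comm 1 t)) (⟨10⟩-+ t 1 w)

opt-1∷ : ∀ m → ∃ λ w → opt (1 + m) ≡ 1b ∷ w × length w ≡ m
opt-1∷ zero          = [] , refl , refl
opt-1∷ (suc zero)    = _ , refl , refl
opt-1∷ (suc (suc m)) = _ , refl , cong suc (length-opt (suc m))

⟨10⟩0≺⟨10⟩1 : ∀ t {x y} → length x ≡ length y → ⟨10⟩^ t ++ 0b ∷ x ≺ ⟨10⟩^ t ++ 1b ∷ y
⟨10⟩0≺⟨10⟩1 t eq = ++-≺ (⟨10⟩^ t) (here eq)

insert : ℕ → ℕ → Word
insert t m = ⟨10⟩^ t ++ 0b ∷ opt m

insert≺later : ∀ t m z → length z ≡ m → insert t (2 + m) ≺ ⟨10⟩^ (suc t) ++ 0b ∷ z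
insert≺later t m z eq = subst (insert t (2 + m) ≺_) (sym (⟨10⟩-suc t (0b ∷ z)))
  (⟨10⟩0≺⟨10⟩1 t (trans (length-opt (2 + m)) (cong (2 +_) (sym eq))))

-- Words that start with u, where u leads to the pair (p , r + p) of Stern values.
module WithPrefix (u : Word) (r p : ℕ) (p<r : p < r) (eval-u : ∀ w → ⟦ u ++ w ⟧ ≡ eval p (r + p) w) where

  ⟦insert⟧ : ∀ t m → ⟦ u ++ insert t (1 + m) ⟧ ≡ inserted r p t (1 + m)
  ⟦insert⟧ t m = trans (eval-u (insert t (1 + m))) (trans (eval-⟨10⟩₀ r p t _) (eval-opt _ _ m))

  ⟦0∷⟧≤ : ∀ t z → ⟦ u ++ ⟨10⟩^ t ++ 0b ∷ z ⟧ ≤ inserted r p t (length z)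
  ⟦0∷⟧≤ t z = ≤-trans
    (≤-reflexive (trans (eval-u (⟨10⟩^ t ++ 0b ∷ z)) (eval-⟨10⟩₀ r p t (0b ∷ z))))
    (eval≤bound (m≤n+m _ _) z)

  dominated-by-insert : ∀ t m w → length w ≡ 1 + m → opt (1 + m) ≺ w →
    Dominated (value (u ++ ⟨10⟩^ t ++ 0b ∷ w))
  dominated-by-insert t m w eq lt = dominated (++-≺ u (++-≺ (⟨10⟩^ t) (there 0b lt)))
    (subst (⟦ u ++ ⟨10⟩^ t ++ 0b ∷ w ⟧ ≤_) (sym (⟦insert⟧ t m))
      (subst (λ l → ⟦ u ++ ⟨10⟩^ t ++ 0b ∷ w ⟧ ≤ inserted r p t l) eq (⟦0∷⟧≤ t w)))

  -- The smaller word has its 0 one block earlier and an optimal tail; past the middle this move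
  -- loses nothing.
  dominated-after-middle : ∀ c e z → length z ≡ 1 + c * 2 →
    Dominated (value (u ++ ⟨10⟩^ (2 + c + e) ++ 0b ∷ z))
  dominated-after-middle c e z eq = dominated (++-≺ u (insert≺later (1 + c + e) (1 + c * 2) z eq)) (begin
    ⟦ u ++ ⟨10⟩^ (2 + c + e) ++ 0b ∷ z ⟧      ≤⟨ ⟦0∷⟧≤ (2 + c + e) z ⟩
    inserted r p (2 + c + e) (length z)       ≡⟨ cong (inserted r p (2 + c + e)) eq ⟩
    inserted r p (2 + c + e) (1 + c * 2)      ≤⟨ inserted-falls-after-middle r p c e ⟩
    inserted r p (1 + c + e) (3 + c * 2)      ≡⟨ ⟦insert⟧ (1 + c + e) (2 + c * 2) ⟨
    ⟦ u ++ insert (1 + c + e) (3 + c * 2) ⟧   ∎)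
    where open ≤-Reasoning

  -- The smaller word has a single 0, inserted after one block `10`; it comes first because the
  -- given word starts with at least two blocks. `numeric` says that the factor (31/21)² is too
  -- small to compensate.
  dominated-two-insertions : 8 * p ≤ 5 * (r + p) →
    (∀ m → 31 * (31 * bound p (r + p) (4 + m)) ≤ 21 * (21 * inserted r p 1 (3 + m))) →
    ∀ s t m z → length z ≡ 1 + m →
    Dominated (value (u ++ ⟨10⟩^ (2 + s) ++ 0b ∷ ⟨10⟩^ t ++ 0b ∷ z))
  dominated-two-insertions ratio numeric s t m z eq = dominated
    (++-≺ u (there 1b (there 0b (here len))))
    (*-cancelˡ-≤ 21 (*-cancelˡ-≤ 21 (begin
      21 * (21 * ⟦ u ++ y ⟧)            ≡⟨ cong (λ e → 21 * (21 * e)) (eval-u y) ⟩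
      21 * (21 * eval p (r + p) y)      ≤⟨ eval-two-insertions p (r + p) ratio (2 + s) t m z eq ⟩
      31 * (31 * bound p (r + p) (4 + N)) ≤⟨ numeric N ⟩
      21 * (21 * inserted r p 1 (3 + N))  ≡⟨ cong (λ e → 21 * (21 * e)) (⟦insert⟧ 1 (2 + N)) ⟨
      21 * (21 * ⟦ u ++ insert 1 (3 + N) ⟧) ∎)))
    where
    open ≤-Reasoning
    y = ⟨10⟩^ (2 + s) ++ 0b ∷ ⟨10⟩^ t ++ 0b ∷ z
    N = s * 2 + (t * 2 + (1 + m))
    N′ : ∀ s t m → 3 + (s + (t + (1 + m))) ≡ 1 + (s + suc (t + suc (1 + m)))
    N′ = solve-∀
    len : length (opt (3 + N)) ≡ length (0b ∷ ⟨10⟩^ s ++ 0b ∷ ⟨10⟩^ t ++ 0b ∷ z)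
    len rewrite length-opt (3 + N) | length-⟨10⟩ s (0b ∷ ⟨10⟩^ t ++ 0b ∷ z) | length-⟨10⟩ t (0b ∷ z) | eq =
      N′ (s * 2) (t * 2) m

  private
    insert-⊏ : ∀ t m → inserted r p t (3 + m) < inserted r p (1 + t) (1 + m) →
      u ++ insert t (3 + m) ⊏ u ++ insert (1 + t) (1 + m)
    insert-⊏ t m lt = ++-≺ u (insert≺later t (1 + m) (opt (1 + m)) (length-opt (1 + m)))
      , subst₂ _<_ (sym (⟦insert⟧ t (2 + m))) (sym (⟦insert⟧ (1 + t) m)) lt

  insert-even-⊏ : ∀ t j → u ++ insert t (2 + suc j * 2) ⊏ u ++ insert (1 + t) (2 + j * 2)
  insert-even-⊏ t j = insert-⊏ t (1 + j * 2) (inserted-rises r p p<r t (suc j))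

  insert-odd-⊏ : ∀ t d → u ++ insert t (1 + suc (t + d) * 2) ⊏ u ++ insert (1 + t) (1 + (t + d) * 2)
  insert-odd-⊏ t d = insert-⊏ t ((t + d) * 2) (inserted-rises-before-middle r p p<r t d)

  insert-⊏-opt : ∀ t m → u ++ insert t (1 + m) ⊏ u ++ ⟨10⟩^ t ++ opt (2 + m)
  insert-⊏-opt t m with opt-1∷ (1 + m)
  ... | w , eq , |w| = ++-≺ u (subst (λ x → insert t (1 + m) ≺ ⟨10⟩^ t ++ x) (sym eq)
                          (⟨10⟩0≺⟨10⟩1 t (trans (length-opt (1 + m)) (sym |w|))))
    , subst₂ _<_ (sym (⟦insert⟧ t m))
        (sym (trans (eval-u (⟨10⟩^ t ++ opt (2 + m))) (trans (eval-⟨10⟩₀ r p t _) (eval-opt _ _ (1 + m)))))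
        (inserted<bound r p p<r t m)

  011⊏101 : ∀ t → u ++ ⟨10⟩^ t ++ 0b ∷ 1b ∷ 1b ∷ [] ⊏ u ++ ⟨10⟩^ t ++ 1b ∷ 0b ∷ 1b ∷ []
  011⊏101 t = ++-≺ u (⟨10⟩0≺⟨10⟩1 t refl)
    , subst₂ _<_ (sym (trans (eval-u (⟨10⟩^ t ++ 0b ∷ 1b ∷ 1b ∷ [])) (eval-⟨10⟩₀ r p t _)))
                 (sym (trans (eval-u (⟨10⟩^ t ++ 1b ∷ 0b ∷ 1b ∷ [])) (eval-⟨10⟩₀ r p t _)))
        (≤-by 0 (gib>0 r p p<r t) (eq (gib r p (t * 2)) (gib r p (1 + t * 2))))
    where
    eq : ∀ a b → suc (b + (a + b + b) + (a + b + b)) + a + 0 ≡ b + (a + b) + (a + b + (b + (a + b))) + 1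
    eq = solve-∀

module ∅ = WithPrefix [] 1 0 z<s (λ _ → refl)
module 100⋯ = WithPrefix (1b ∷ 0b ∷ 0b ∷ []) 2 1 (s≤s z<s) (λ _ → refl)
module 100100⋯ = WithPrefix (1b ∷ 0b ∷ 0b ∷ 1b ∷ 0b ∷ 0b ∷ []) 7 4 (s≤s (s≤s (s≤s (s≤s z<s)))) (λ _ → refl)

dominated-∅-two-insertions : ∀ s t m z → length z ≡ 1 + m →
  Dominated (value (⟨10⟩^ (2 + s) ++ 0b ∷ ⟨10⟩^ t ++ 0b ∷ z))
dominated-∅-two-insertions = ∅.dominated-two-insertions z≤n λ m →
  -- With f = `fib (3 + m)` and g = `fib (4 + m)` the claim is 520f ≤ 362g; 174 times 3f ≤ 2g gives
  -- 522f ≤ 348g.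
  ≤-by (14 * fib (4 + m) + 2 * fib (3 + m)) (*-monoʳ-≤ 174 (2fib-suc≥3fib (1 + m))) (eq (fib (3 + m)) (fib (4 + m)))
  where
  eq : ∀ f g → 31 * (31 * (0 * g + 1 * (f + g))) + 174 * (2 * g) + (14 * g + 2 * f)
             ≡ 21 * (21 * (1 * f + 3 * g)) + 174 * (3 * f)
  eq = solve-∀

dominated-100-two-insertions : ∀ s t m z → length z ≡ 1 + m →
  Dominated (value (1b ∷ 0b ∷ 0b ∷ ⟨10⟩^ (2 + s) ++ 0b ∷ ⟨10⟩^ t ++ 0b ∷ z))
dominated-100-two-insertions = 100⋯.dominated-two-insertions (toWitness {a? = 8 ≤? 15} _) λ m →
  -- Here the claim is 1119f ≤ 1007g, and 373 times 3f ≤ 2g gives 1119f ≤ 746g.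
  ≤-by (261 * fib (4 + m)) (*-monoʳ-≤ 373 (2fib-suc≥3fib (1 + m))) (eq (fib (3 + m)) (fib (4 + m)))
  where
  eq : ∀ f g → 31 * (31 * (1 * g + 3 * (f + g))) + 373 * (2 * g) + 261 * g
             ≡ 21 * (21 * (4 * f + 11 * g)) + 373 * (3 * f)
  eq = solve-∀

-- After 1000 a further insertion costs so much that the optimal word with one bit fewer is already
-- at least as good.
dominated-1000 : ∀ t m z N → length z ≡ 1 + m → t * 2 + (1 + m) ≡ 3 + N →
  Dominated (value (1b ∷ 0b ∷ 0b ∷ 0b ∷ ⟨10⟩^ t ++ 0b ∷ z))
dominated-1000 t m z N eq t+m≡3+N = value (opt (7 + N)) , smaller ,
  subst₂ _≤_ (sym (stern-value (1b ∷ 0b ∷ 0b ∷ 0b ∷ y)))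
    (sym (trans (stern-value (opt (7 + N))) (eval-opt 0 1 (6 + N))))
    (*-cancelˡ-≤ 21 (begin
      21 * eval 1 4 y                     ≤⟨ eval-one-insertion 1 4 (toWitness {a? = 8 ≤? 20} _) t m z eq ⟩
      31 * bound 1 4 (t * 2 + (1 + m))    ≡⟨ cong (λ l → 31 * bound 1 4 l) t+m≡3+N ⟩
      -- With f = `fib (3 + N)` and g = `fib (4 + N)` this is 19g ≤ 32f; 19 times 3g ≤ 5f gives 57g
      -- ≤ 95f.
      31 * bound 1 4 (3 + N)              ≤⟨ *-cancelˡ-≤ 3 (≤-by (fib (3 + N)) (*-monoʳ-≤ 19 (3fib-suc≤5fib N))
                                                (numeric (fib (3 + N)) (fib (4 + N)))) ⟩
      21 * bound 0 1 (7 + N)              ∎))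
  where
  open ≤-Reasoning
  y = ⟨10⟩^ t ++ 0b ∷ z
  numeric : ∀ f g → 3 * (31 * (1 * f + 4 * g)) + 19 * (5 * f) + f
            ≡ 3 * (21 * (0 * (f + g + (g + (f + g))) + 1 * (g + (f + g) + (f + g + (g + (f + g))))))
              + 19 * (3 * g)
  numeric = solve-∀
  |y| : length y ≡ 4 + N
  |y| rewrite length-⟨10⟩ t (0b ∷ z) | eq = trans (+-suc (t * 2) (1 + m)) (cong suc t+m≡3+N)
  smaller : value (opt (7 + N)) < value (1b ∷ 0b ∷ 0b ∷ 0b ∷ y)
  smaller rewrite value-1∷ (0b ∷ 0b ∷ 0b ∷ y) | |y| =
    <-≤-trans (subst (λ l → value (opt (7 + N)) < 2 ^ l) (length-opt (7 + N)) (value<2^length (opt (7 + N)))) (m≤m+n _ _)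

⟦1000opt⟧ : ∀ N → ⟦ 1b ∷ 0b ∷ 0b ∷ 0b ∷ opt (3 + N) ⟧ ≡ bound 9 14 N
⟦1000opt⟧ N = trans (eval-opt 1 4 (2 + N)) (eq (fib N) (fib (1 + N)))
  where
  eq : ∀ f g → 1 * (g + (f + g)) + 4 * (f + g + (g + (f + g))) ≡ 9 * f + 14 * g
  eq = solve-∀

dominated-by-1000 : ∀ N y → length y ≡ 1 + N → ⟦ 1b ∷ 0b ∷ 0b ∷ 1b ∷ 0b ∷ 0b ∷ y ⟧ ≤ bound 9 14 N →
  Dominated (value (1b ∷ 0b ∷ 0b ∷ 1b ∷ 0b ∷ 0b ∷ y))
dominated-by-1000 N y eq le = dominated
  {x = 1b ∷ 0b ∷ 0b ∷ 0b ∷ opt (3 + N)} {y = 1b ∷ 0b ∷ 0b ∷ 1b ∷ 0b ∷ 0b ∷ y}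
  (there 1b (there 0b (there 0b (here (trans (length-opt (3 + N)) (cong (2 +_) (sym eq)))))))
  (subst (⟦ 1b ∷ 0b ∷ 0b ∷ 1b ∷ 0b ∷ 0b ∷ y ⟧ ≤_) (sym (⟦1000opt⟧ N)) le)

dominated-100100 : ∀ t z m → length z ≡ m → 3 * fib (1 + m) ≤ 5 * fib m →
  Dominated (value (1b ∷ 0b ∷ 0b ∷ 1b ∷ 0b ∷ 0b ∷ ⟨10⟩^ t ++ 0b ∷ z))
dominated-100100 t z m refl ratio = dominated-by-1000 (t * 2 + m) (⟨10⟩^ t ++ 0b ∷ z)
  (trans (length-⟨10⟩ t (0b ∷ z)) (+-suc (t * 2) m))
  (≤-trans (100100⋯.⟦0∷⟧≤ t z) (inserted-7-4≤ t m ratio))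

dominated-100100-00 : ∀ t d →
  Dominated (value (1b ∷ 0b ∷ 0b ∷ 1b ∷ 0b ∷ 0b ∷ ⟨10⟩^ t ++ 0b ∷ 0b ∷ d ∷ []))
dominated-100100-00 t d = dominated-by-1000 (t * 2 + 2) (⟨10⟩^ t ++ 0b ∷ 0b ∷ d ∷ [])
  (trans (length-⟨10⟩ t (0b ∷ 0b ∷ d ∷ [])) (+-suc (t * 2) 2))
  (≤-trans (≤-reflexive (eval-⟨10⟩₀ 7 4 t (0b ∷ 0b ∷ d ∷ [])))
    (≤-trans (eval≤bound (m≤n+m _ _) (d ∷ [])) (00-7-4≤ t)))

dominated-by-opt : ∀ m w → length w ≡ 1 + m → opt (1 + m) ≺ w → Dominated (value w)
dominated-by-opt m w eq lt = dominated lt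
  (subst (⟦ w ⟧ ≤_) (sym (eval-opt 0 1 m)) (subst (λ l → ⟦ w ⟧ ≤ bound 0 1 l) eq (eval≤bound z≤n w)))

-- Parity and index arithmetic

half-even : ∀ t m n → t * 2 + m ≡ n * 2 → ∃ λ c → m ≡ c * 2 × n ≡ t + c
half-even zero    m n       eq = n , eq , refl
half-even (suc t) m (suc n) eq with half-even t m n (suc-injective (suc-injective eq))
... | c , m≡ , n≡ = c , m≡ , cong suc n≡

half-odd : ∀ t m n → t * 2 + m ≡ 1 + n * 2 → ∃ λ c → m ≡ 1 + c * 2 × n ≡ t + c
half-odd zero    m n       eq = n , eq , refl
half-odd (suc t) m (suc n) eq with half-odd t m n (suc-injective (suc-injective eq))
... | c , m≡ , n≡ = c , m≡ , cong suc n≡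

∸-∸-cancel : ∀ a b y {x} → x ≡ a + b + y → x ∸ a ∸ b ≡ y
∸-∸-cancel a b y refl = trans (∸-+-assoc (a + b + y) a b) (m+n∸m≡n (a + b) y)

∈-range : ∀ lo hi {a} → lo ≤ a → a ≤ hi → a ∈ range lo hi
∈-range lo hi {a} lo≤a a≤hi = subst (_∈ range lo hi) (m+[n∸m]≡n lo≤a)
  (∈-map⁺ (lo +_) (∈-upTo⁺ (subst (_≤ suc hi ∸ lo) (+-∸-assoc 1 lo≤a) (∸-monoˡ-≤ lo (s≤s a≤hi)))))

≤⌊/2⌋ : ∀ {b n} → b + b ≤ n → b ≤ ⌊ n /2⌋
≤⌊/2⌋ {b} b+b≤n = subst (_≤ _) (sym (n≡⌊n+n/2⌋ b)) (⌊n/2⌋-mono b+b≤n)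

-- Classification of k-bit words

Classified : List Word → Word → Set
Classified ws x = x ∈ ws ⊎ Dominated (value x)

even-A even-B odd-D odd-E : ℕ → ℕ → Word
even-A n a = (1b ∷ 0b ∷ 0b ∷ []) ++ ⟨10⟩^ a ++ [ 0b ] ++ ⟨10⟩^ (n ∸ 3 ∸ a) ++ (1b ∷ 1b ∷ [])
even-B n b = ⟨10⟩^ b ++ [ 0b ] ++ ⟨10⟩^ (n ∸ b ∸ 1) ++ [ 1b ]
odd-D  n b = (1b ∷ 0b ∷ 0b ∷ []) ++ ⟨10⟩^ b ++ [ 0b ] ++ ⟨10⟩^ (n ∸ 2 ∸ b) ++ [ 1b ]
odd-E  n a = ⟨10⟩^ (a + 1) ++ [ 0b ] ++ ⟨10⟩^ (n ∸ 2 ∸ a) ++ (1b ∷ 1b ∷ [])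

even-A≡ : ∀ n a j → n ≡ 3 + a + j → even-A n a ≡ 1b ∷ 0b ∷ 0b ∷ insert a (2 + j * 2)
even-A≡ n a j eq rewrite ∸-∸-cancel 3 a j eq | opt-even j = refl

even-B≡ : ∀ n b c → n ≡ b + 1 + c → even-B n b ≡ insert b (1 + c * 2)
even-B≡ n b c eq rewrite ∸-∸-cancel b 1 c eq | opt-odd c = refl

odd-D≡ : ∀ n b c → n ≡ 2 + b + c → odd-D n b ≡ 1b ∷ 0b ∷ 0b ∷ insert b (1 + c * 2)
odd-D≡ n b c eq rewrite ∸-∸-cancel 2 b c eq | opt-odd c = refl

odd-E≡ : ∀ n a j → n ≡ 2 + a + j → odd-E n a ≡ insert (1 + a) (2 + j * 2)
odd-E≡ n a j eq rewrite ∸-∸-cancel 2 a j eq | opt-even j | +-comm a 1 = refl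

odd-O₂ : ℕ → Word
odd-O₂ t = (1b ∷ 0b ∷ 0b ∷ 1b ∷ 0b ∷ 0b ∷ []) ++ ⟨10⟩^ t ++ (0b ∷ 1b ∷ 1b ∷ [])

module _ (n : ℕ) where

  even-A∈ : ∀ a j → n ≡ 3 + a + j → (1b ∷ 0b ∷ 0b ∷ insert a (2 + j * 2)) ∈ evenWords n
  even-A∈ a j eq = subst (_∈ evenWords n) (even-A≡ n a j eq)
    (∈-++⁺ˡ (∈-map⁺ (even-A n) (∈-range 0 (n ∸ 3) z≤n (subst (λ n → a ≤ n ∸ 3) (sym eq) (m≤m+n a j)))))

  even-B∈ : ∀ b c → n ≡ suc b + 1 + c → b ≤ c → insert (suc b) (1 + c * 2) ∈ evenWords n
  even-B∈ b c eq b≤c = subst (_∈ evenWords n) (even-B≡ n (suc b) c eq)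
    (∈-++⁺ʳ (map (even-A n) (range 0 (n ∸ 3)))
      (∈-++⁺ˡ (∈-map⁺ (even-B n) (∈-range 1 ⌊ n /2⌋ (s≤s z≤n) (≤⌊/2⌋
        (subst (suc b + suc b ≤_) (trans (arith b c) (sym eq)) (s≤s (+-monoʳ-≤ b (s≤s b≤c)))))))))
    where
    arith : ∀ b c → suc (b + suc c) ≡ suc b + 1 + c
    arith = solve-∀

  even-C∈ : ∀ m → n ≡ suc m → opt (2 + m * 2) ∈ evenWords n
  even-C∈ m refl = subst (_∈ evenWords (suc m)) (sym (opt-even m))
    (∈-++⁺ʳ (map (even-A n) (range 0 (n ∸ 3))) (∈-++⁺ʳ (map (even-B n) (range 1 ⌊ n /2⌋)) (here refl)))

  -- The tail z has even length, so its optimal filling is listed for every t. A further insertion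
  -- loses to 1000... for t = 1, to a single insertion for t ≥ 2, and to a shorter word for t = 0.
  classify-even-100 : ∀ t j z → n ≡ 3 + t + j → 6 ≤ n → length z ≡ 2 + j * 2 → AgainstOpt z →
    Classified (evenWords n) (1b ∷ 0b ∷ 0b ∷ ⟨10⟩^ t ++ 0b ∷ z)
  classify-even-100 t j _ n≡ _ |z| (ends0 e) =
    inj₂ (dominated-even (1b ∷ 0b ∷ 0b ∷ ++-EndsIn0 (⟨10⟩^ t) (0b ∷ e)))
  classify-even-100 t j _ n≡ _ |z| (equal m) with suc-injective (trans (sym (length-opt (1 + m))) |z|)
  ... | refl = inj₁ (even-A∈ t j n≡)
  classify-even-100 t j _ n≡ _ |z| (after m eq lt) = inj₂ (100⋯.dominated-by-insert t m _ eq lt)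
  classify-even-100 t j _ n≡ 6≤n |z| (before s m z eq) =
    inj₂ (dominate t n≡ (trans (cong (λ l → s * 2 + suc l) (sym eq)) (trans (sym (length-⟨10⟩ s (0b ∷ z))) |z|)))
    where
    odd-ratio : ∀ i → 3 * fib (2 + i * 2) ≤ 5 * fib (1 + i * 2)
    odd-ratio zero    = s≤s (s≤s (s≤s z≤n))
    odd-ratio (suc i) = 3fib-suc≤5fib (i * 2)

    dominate : ∀ t → n ≡ 3 + t + j → s * 2 + (2 + m) ≡ 2 + j * 2 →
      Dominated (value (1b ∷ 0b ∷ 0b ∷ ⟨10⟩^ t ++ 0b ∷ ⟨10⟩^ s ++ 0b ∷ z))
    -- 6 ≤ n forces j ≥ 3, which makes the tail long enough for `dominated-1000`.
    dominate zero n≡ |⋯| with m≤n⇒∃[o]m+o≡n (+-cancelˡ-≤ 3 3 j (subst (6 ≤_) n≡ 6≤n))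
    ... | o , refl = dominated-1000 s m z (4 + o * 2) eq (suc-injective (trans (sym (+-suc (s * 2) (1 + m))) |⋯|))
    dominate (suc zero) n≡ |⋯| with half-even s (2 + m) (suc j) |⋯|
    -- The length of z is odd here, so the exceptional length 2 does not occur.
    ... | suc i , refl , _ = dominated-100100 s z (1 + m) eq (odd-ratio i)
    dominate (suc (suc t)) n≡ |⋯| = dominated-100-two-insertions t s m z eq

  -- The tail after the first inserted 0 has odd length, so that family stops at the middle. A
  -- second insertion is dominated unless the first follows a single block, which leaves the prefix
  -- 100.
  classify-even : ∀ x → 6 ≤ n → length x ≡ n * 2 → AgainstOpt x → ∀ w → x ≡ 1b ∷ w → Classified (evenWords n) x
  classify-even _ _   |x| (ends0 e)       w refl = inj₂ (dominated-even e)
  classify-even _ _   |x| (after m eq lt) w x≡ = inj₂ (dominated-by-opt m _ eq lt)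
  classify-even _ 6≤n |x| (equal m)       w x≡ with m≤n⇒∃[o]m+o≡n (≤-trans (s≤s (z≤n {5})) 6≤n)
  ... | o , refl with suc-injective (trans (sym (length-opt (1 + m))) |x|)
  ...   | refl = inj₁ (even-C∈ o refl)
  classify-even _ 6≤n |x| (before zero m (d ∷ z) eq) w ()
  classify-even _ 6≤n |x| (before (suc b) m (d ∷ z) eq) w x≡
    with half-even b (2 + m) (pred n) (trans (cong (λ l → b * 2 + suc l) (sym eq)) (trans (sym (length-⟨10⟩ b (0b ∷ d ∷ z))) (pred-* n |x|)))
    where
    pred-* : ∀ n {l} → suc (suc l) ≡ n * 2 → l ≡ pred n * 2
    pred-* (suc n) eq = suc-injective (suc-injective eq)
  ... | suc c , refl , pred-n≡ with b ≤? c
  ...   | no b≰c with m≤n⇒∃[o]m+o≡n (≰⇒> b≰c)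
  ...     | e , refl = inj₂ (∅.dominated-after-middle c e (d ∷ z) eq)
  classify-even _ 6≤n |x| (before (suc b) m (d ∷ z) eq) w x≡
      | suc c , refl , pred-n≡ | yes b≤c = inner b b≤c pred-n≡ eq (againstOpt d z)
    where
    n≡ : ∀ b c → pred n ≡ b + suc c → n ≡ 2 + b + c
    n≡ b c eq = trans (sym (suc-pred n {{>-nonZero (≤-trans (s≤s z≤n) 6≤n)}})) (trans (cong suc eq) (cong suc (+-suc b c)))

    inner : ∀ b {y} → b ≤ c → pred n ≡ b + suc c → length y ≡ 1 + c * 2 → AgainstOpt y →
      Classified (evenWords n) (⟨10⟩^ (suc b) ++ 0b ∷ y)
    inner b b≤c pred-n≡ |y| (ends0 e)       = inj₂ (dominated-even (1b ∷ 0b ∷ ++-EndsIn0 (⟨10⟩^ b) (0b ∷ e)))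
    inner b b≤c pred-n≡ |y| (after m eq lt) = inj₂ (∅.dominated-by-insert (suc b) m _ eq lt)
    inner b b≤c pred-n≡ |y| (equal m) with suc-injective (trans (sym (length-opt (1 + m))) |y|)
    ... | refl = inj₁ (even-B∈ b c (trans (n≡ b c pred-n≡) (arith b c)) b≤c)
      where
      arith : ∀ b c → 2 + b + c ≡ suc b + 1 + c
      arith = solve-∀
    inner (suc b) b≤c pred-n≡ |y| (before t m y eq) = inj₂ (dominated-∅-two-insertions b t m y eq)
    inner zero    b≤c pred-n≡ |y| (before t m (d ∷ y) eq)
      with half-odd t (2 + m) c (trans (cong (λ l → t * 2 + suc l) (sym eq)) (trans (sym (length-⟨10⟩ t (0b ∷ d ∷ y))) |y|))
    ... | suc j , refl , c≡ = classify-even-100 t j (d ∷ y)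
      (trans (n≡ 0 c pred-n≡) (trans (cong (2 +_) c≡) (cong (2 +_) (+-suc t j)))) 6≤n eq (againstOpt d y)

  odd-O₁∈ : ∀ c → n ≡ 2 + c → (1b ∷ 0b ∷ 0b ∷ insert 0 (1 + c * 2)) ∈ oddWords n
  odd-O₁∈ c refl = here (cong (λ w → 1b ∷ 0b ∷ 0b ∷ 0b ∷ w) (opt-odd c))

  odd-O₂∈ : ∀ t → n ≡ 4 + t → odd-O₂ t ∈ oddWords n
  odd-O₂∈ t refl = there (here refl)

  odd-D∈ : ∀ b c → n ≡ 2 + suc b + c → b ≤ c → (1b ∷ 0b ∷ 0b ∷ insert (suc b) (1 + c * 2)) ∈ oddWords n
  odd-D∈ b c eq b≤c = subst (_∈ oddWords n) (odd-D≡ n (suc b) c eq)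
    (there (there (∈-++⁺ˡ (∈-map⁺ (odd-D n) (∈-range 1 (⌈ n /2⌉ ∸ 1) (s≤s z≤n)
      (∸-monoˡ-≤ 1 (≤⌊/2⌋ {2 + b} (subst (λ n → 2 + b + (2 + b) ≤ suc n) (sym eq)
        (subst (_≤ 4 + b + c) (arith b) (+-monoʳ-≤ (4 + b) b≤c))))))))))
    where
    arith : ∀ b → 4 + b + b ≡ 2 + b + (2 + b)
    arith = solve-∀

  odd-E∈ : ∀ a j → n ≡ 2 + a + j → insert (1 + a) (2 + j * 2) ∈ oddWords n
  odd-E∈ a j eq = subst (_∈ oddWords n) (odd-E≡ n a j eq)
    (there (there (∈-++⁺ʳ (map (odd-D n) (range 1 (⌈ n /2⌉ ∸ 1))) (∈-++⁺ˡ (∈-map⁺ (odd-E n)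
      (∈-range 0 (n ∸ 2) z≤n (subst (λ n → a ≤ n ∸ 2) (sym eq) (m≤m+n a j))))))))

  odd-last∈ : opt (1 + n * 2) ∈ oddWords n
  odd-last∈ = subst (_∈ oddWords n) (sym (opt-odd n))
    (there (there (∈-++⁺ʳ (map (odd-D n) (range 1 (⌈ n /2⌉ ∸ 1)))
      (∈-++⁺ʳ (map (odd-E n) (range 0 (n ∸ 2))) (here refl)))))

  -- The length of z is even, so the exceptional length 2 occurs: 11 is the listed word, 10 is even,
  -- and a leading 0 loses to 1000....
  classify-odd-100100 : ∀ s i z → n ≡ 4 + s + i → length z ≡ 2 + i * 2 →
    Classified (oddWords n) (1b ∷ 0b ∷ 0b ∷ 1b ∷ 0b ∷ 0b ∷ ⟨10⟩^ s ++ 0b ∷ z)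
  classify-odd-100100 s (suc i) z n≡ |z| = inj₂ (dominated-100100 s z (4 + i * 2) |z| (3fib-suc≤5fib (1 + i * 2)))
  classify-odd-100100 s zero (zero ∷ d ∷ [])           n≡ |z| = inj₂ (dominated-100100-00 s d)
  classify-odd-100100 s zero (suc zero ∷ zero ∷ [])     n≡ |z| =
    inj₂ (dominated-even (1b ∷ 0b ∷ 0b ∷ 1b ∷ 0b ∷ 0b ∷ ++-EndsIn0 (⟨10⟩^ s) (0b ∷ 1b ∷ last0)))
  classify-odd-100100 s zero (suc zero ∷ suc zero ∷ []) n≡ |z| =
    inj₁ (odd-O₂∈ s (trans n≡ (cong (4 +_) (+-identityʳ s))))

  -- The parities are opposite to those for even k: here z has odd length and the family stops at
  -- the middle. The hypothesis t ≤ `suc j` is what `dominated-after-middle` leaves over.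
  classify-odd-100 : ∀ t j z → n ≡ 2 + t + j → 6 ≤ n → t ≤ suc j → length z ≡ 1 + j * 2 → AgainstOpt z →
    Classified (oddWords n) (1b ∷ 0b ∷ 0b ∷ ⟨10⟩^ t ++ 0b ∷ z)
  classify-odd-100 t j _ n≡ _ _ |z| (ends0 e) =
    inj₂ (dominated-even (1b ∷ 0b ∷ 0b ∷ ++-EndsIn0 (⟨10⟩^ t) (0b ∷ e)))
  classify-odd-100 t j _ n≡ _ _ |z| (after m eq lt) = inj₂ (100⋯.dominated-by-insert t m _ eq lt)
  classify-odd-100 t j _ n≡ _ t≤ |z| (equal m) with suc-injective (trans (sym (length-opt (1 + m))) |z|)
  classify-odd-100 zero    j _ n≡ _ t≤       |z| (equal m) | refl = inj₁ (odd-O₁∈ j n≡)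
  classify-odd-100 (suc t) j _ n≡ _ (s≤s t≤) |z| (equal m) | refl = inj₁ (odd-D∈ t j n≡ t≤)
  classify-odd-100 t j _ n≡ 6≤n _ |z| (before s m z eq) =
    dominate t n≡ (trans (cong (λ l → s * 2 + suc l) (sym eq)) (trans (sym (length-⟨10⟩ s (0b ∷ z))) |z|))
    where
    dominate : ∀ t → n ≡ 2 + t + j → s * 2 + (2 + m) ≡ 1 + j * 2 →
      Classified (oddWords n) (1b ∷ 0b ∷ 0b ∷ ⟨10⟩^ t ++ 0b ∷ ⟨10⟩^ s ++ 0b ∷ z)
    dominate zero n≡ |⋯| with m≤n⇒∃[o]m+o≡n (+-cancelˡ-≤ 2 4 j (subst (6 ≤_) n≡ 6≤n))
    ... | o , refl = inj₂ (dominated-1000 s m z (5 + o * 2) eq (suc-injective (trans (sym (+-suc (s * 2) (1 + m))) |⋯|)))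
    dominate (suc zero) n≡ |⋯| with half-odd s (2 + m) j |⋯|
    ... | suc i , refl , j≡ =
      classify-odd-100100 s i z (trans n≡ (cong (3 +_) (trans j≡ (+-suc s i)))) eq
    dominate (suc (suc t)) n≡ |⋯| = inj₂ (dominated-100-two-insertions t s m z eq)

  classify-odd : ∀ x → 6 ≤ n → length x ≡ 1 + n * 2 → AgainstOpt x → ∀ w → x ≡ 1b ∷ w → Classified (oddWords n) x
  classify-odd _ _   |x| (ends0 e)       w refl = inj₂ (dominated-even e)
  classify-odd _ _   |x| (after m eq lt) w x≡ = inj₂ (dominated-by-opt m _ eq lt)
  classify-odd _ 6≤n |x| (equal m)       w x≡ with suc-injective (trans (sym (length-opt (1 + m))) |x|)
  ... | refl = inj₁ odd-last∈
  classify-odd _ 6≤n |x| (before zero m (d ∷ z) eq) w ()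
  classify-odd _ 6≤n |x| (before (suc b) m (d ∷ z) eq) w x≡
    with half-odd (suc b) (2 + m) n (trans (cong (λ l → 2 + (b * 2 + suc l)) (sym eq))
           (trans (cong (2 +_) (sym (length-⟨10⟩ b (0b ∷ d ∷ z)))) |x|))
  ... | suc c , refl , n≡ = inner b (trans n≡ (cong suc (+-suc b c))) eq (againstOpt d z)
    where
    inner : ∀ b {y} → n ≡ 2 + b + c → length y ≡ 2 + c * 2 → AgainstOpt y →
      Classified (oddWords n) (⟨10⟩^ (suc b) ++ 0b ∷ y)
    inner b n≡ |y| (ends0 e)       = inj₂ (dominated-even (1b ∷ 0b ∷ ++-EndsIn0 (⟨10⟩^ b) (0b ∷ e)))
    inner b n≡ |y| (after m eq lt) = inj₂ (∅.dominated-by-insert (suc b) m _ eq lt)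
    inner b n≡ |y| (equal m) with suc-injective (trans (sym (length-opt (1 + m))) |y|)
    ... | refl = inj₁ (odd-E∈ b c n≡)
    inner (suc b) n≡ |y| (before t m y eq) = inj₂ (dominated-∅-two-insertions b t m y eq)
    inner zero    n≡ |y| (before t m (d ∷ y) eq)
      with half-even t (2 + m) (suc c) (trans (cong (λ l → t * 2 + suc l) (sym eq)) (trans (sym (length-⟨10⟩ t (0b ∷ d ∷ y))) |y|))
    ... | suc j , refl , c≡ with t ≤? suc j
    ...   | yes t≤ = classify-odd-100 t j (d ∷ y) n≡′ 6≤n t≤ eq (againstOpt d y)
      where
      n≡′ : n ≡ 2 + t + j
      n≡′ = trans n≡ (cong suc (trans c≡ (+-suc t j)))
    ...   | no t≰ with m≤n⇒∃[o]m+o≡n (≰⇒> t≰)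
    ...     | e , refl = inj₂ (100⋯.dominated-after-middle j e (d ∷ y) eq)

-- The listed words are ascending

Ascending-range : ∀ (f : ℕ → Word) lo h → (∀ i → i < h → f (lo + i) ⊏ f (lo + suc i)) →
  Ascending (f (lo + 0)) (map f (map (lo +_) (upTo (suc h)))) (f (lo + h))
Ascending-range f lo h step =
  subst (λ ws → Ascending (f (lo + 0)) ws (f (lo + h)))
    (sym (trans (sym (map-∘ (upTo (suc h)))) (map-upTo (λ i → f (lo + i)) (suc h))))
    (Ascending-applyUpTo (λ i → f (lo + i)) h step)

length-map-range : ∀ (f : ℕ → Word) lo hi → length (map f (range lo hi)) ≡ suc hi ∸ lo
length-map-range f lo hi =
  trans (length-map f (range lo hi)) (trans (length-map (lo +_) (upTo (suc hi ∸ lo))) (length-upTo (suc hi ∸ lo)))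

-- Provides `beyond`: both lists start with 1000, whose pair is (1 , 4), and the first listed value
-- exceeds the maximum for fewer bits by `fib (1 + m)`.
fib[6+m]<bound-1-4 : ∀ m → fib (6 + m) < bound 1 4 (2 + m)
fib[6+m]<bound-1-4 m = ≤-by 0 (fib>0 m) (eq (fib (1 + m)) (fib (2 + m)))
  where
  eq : ∀ f g → suc (g + (f + g) + (f + g + (g + (f + g)))) + f + 0 ≡ 1 * g + 4 * (f + g) + 1
  eq = solve-∀

2⌊n/2⌋≤n : ∀ n → ⌊ n /2⌋ + ⌊ n /2⌋ ≤ n
2⌊n/2⌋≤n n = subst (⌊ n /2⌋ + ⌊ n /2⌋ ≤_) (⌊n/2⌋+⌈n/2⌉≡n n) (+-monoʳ-≤ ⌊ n /2⌋ (⌊n/2⌋≤⌈n/2⌉ n))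

module _ (n′ : ℕ) where

  private
    n : ℕ
    n = 6 + n′

  even-ascending : Ascending (even-A n 0) (evenWords n) (⟨10⟩^ (n ∸ 1) ++ (1b ∷ 1b ∷ []))
  even-ascending = Ascending-++ (Ascending-range (even-A n) 0 (3 + n′) A-step) A⊏B
    (Ascending-++ (Ascending-range (even-B n) 1 (2 + ⌊ n′ /2⌋) B-step) B⊏C [-])
    where
    A-step : ∀ i → i < 3 + n′ → even-A n i ⊏ even-A n (suc i)
    A-step i i< with m≤n⇒∃[o]m+o≡n i<
    ... | o , eq = subst₂ _⊏_
      (sym (even-A≡ n i (suc o) (cong (3 +_) (trans (sym eq) (sym (+-suc i o))))))
      (sym (even-A≡ n (suc i) o (cong (3 +_) (sym eq))))
      (100⋯.insert-even-⊏ i o)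

    -- The two words agree up to 100 (10)ⁿ⁻³ and then end in 011 and 101.
    A⊏B : even-A n (3 + n′) ⊏ even-B n 1
    A⊏B = subst₂ _⊏_
      (sym (even-A≡ n (3 + n′) 0 (cong (6 +_) (sym (+-identityʳ n′)))))
      (cong (λ w → 1b ∷ 0b ∷ 0b ∷ w) (sym (⟨10⟩-suc (3 + n′) [ 1b ])))
      (100⋯.011⊏101 (3 + n′))

    B-step : ∀ i → i < 2 + ⌊ n′ /2⌋ → even-B n (1 + i) ⊏ even-B n (2 + i)
    -- The number d is the room left before the middle, in the form that `insert-odd-⊏` requires.
    B-step i (s≤s i≤) with m≤n⇒∃[o]m+o≡n (≤-trans (+-mono-≤ (s≤s i≤) (s≤s i≤)) (2⌊n/2⌋≤n (4 + n′)))
    ... | d , eq = subst₂ _⊏_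
      (sym (even-B≡ n (1 + i) (suc (1 + i + d)) (trans (cong (2 +_) (sym eq)) (arith i d))))
      (sym (even-B≡ n (2 + i) (1 + i + d) (trans (cong (2 +_) (sym eq)) (arith′ i d))))
      (∅.insert-odd-⊏ (1 + i) d)
      where
      arith : ∀ i d → 2 + (suc i + suc i + d) ≡ 1 + i + 1 + suc (1 + i + d)
      arith = solve-∀
      arith′ : ∀ i d → 2 + (suc i + suc i + d) ≡ 2 + i + 1 + (1 + i + d)
      arith′ = solve-∀

    B⊏C : even-B n (3 + ⌊ n′ /2⌋) ⊏ ⟨10⟩^ (5 + n′) ++ (1b ∷ 1b ∷ [])
    B⊏C = subst₂ _⊏_
      (sym (even-B≡ n b c (trans (cong (6 +_) (sym (⌊n/2⌋+⌈n/2⌉≡n n′))) (arith ⌊ n′ /2⌋ ⌈ n′ /2⌉))))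
      (trans (cong (⟨10⟩^ b ++_) (opt-even c)) (trans (sym (⟨10⟩-+ b c (1b ∷ 1b ∷ [])))
        (cong (λ t → ⟨10⟩^ t ++ (1b ∷ 1b ∷ [])) (trans (arith′ ⌊ n′ /2⌋ ⌈ n′ /2⌉) (cong (5 +_) (⌊n/2⌋+⌈n/2⌉≡n n′))))))
      (∅.insert-⊏-opt b (c * 2))
      where
      b = 3 + ⌊ n′ /2⌋
      c = 2 + ⌈ n′ /2⌉
      arith : ∀ x y → 6 + (x + y) ≡ 3 + x + 1 + (2 + y)
      arith = solve-∀
      arith′ : ∀ x y → 3 + x + (2 + y) ≡ 5 + (x + y)
      arith′ = solve-∀

  odd-ascending : Ascending (1b ∷ 0b ∷ 0b ∷ 0b ∷ ⟨10⟩^ (4 + n′) ++ [ 1b ]) (oddWords n) (⟨10⟩^ n ++ [ 1b ])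
  odd-ascending = O₁⊏O₂ ∷ (O₂⊏D ∷
    Ascending-++ (Ascending-range (odd-D n) 1 (1 + ⌈ n′ /2⌉) D-step) D⊏E
      (Ascending-++ (Ascending-range (odd-E n) 0 (4 + n′) E-step) E⊏last [-]))
    where
    O₁⊏O₂ : 1b ∷ 0b ∷ 0b ∷ 0b ∷ ⟨10⟩^ (4 + n′) ++ [ 1b ] ⊏ odd-O₂ (2 + n′)
    O₁⊏O₂ = there 1b (there 0b (there 0b (here len)))
      , subst₂ _<_
          (sym (trans (cong (λ w → ⟦ 1b ∷ 0b ∷ 0b ∷ 0b ∷ w ⟧) (trans (sym (opt-odd (4 + n′))) (cong opt (arith (n′ * 2)))))
                      (⟦1000opt⟧ ((2 + n′) * 2 + 2))))
          (sym (100100⋯.⟦insert⟧ (2 + n′) 1))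
          (inserted-7-4> (2 + n′) (gib-1-0-rises n′))
      where
      arith : ∀ x → 9 + x ≡ 3 + (4 + x + 2)
      arith = solve-∀
      len : length (⟨10⟩^ (4 + n′) ++ [ 1b ]) ≡ length (0b ∷ 0b ∷ ⟨10⟩^ (2 + n′) ++ (0b ∷ 1b ∷ 1b ∷ []))
      len rewrite length-⟨10⟩ n′ [ 1b ] | length-⟨10⟩ n′ (0b ∷ 1b ∷ 1b ∷ []) = arith₂ (n′ * 2)
        where
        arith₂ : ∀ x → 8 + (x + 1) ≡ 6 + (x + 3)
        arith₂ = solve-∀

    O₂⊏D : odd-O₂ (2 + n′) ⊏ odd-D n 1
    O₂⊏D = subst (odd-O₂ (2 + n′) ⊏_)
      (cong (λ w → 1b ∷ 0b ∷ 0b ∷ 1b ∷ 0b ∷ 0b ∷ w) (sym (⟨10⟩-suc (2 + n′) [ 1b ])))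
      (100100⋯.011⊏101 (2 + n′))

    D-step : ∀ i → i < 1 + ⌈ n′ /2⌉ → odd-D n (1 + i) ⊏ odd-D n (2 + i)
    D-step i (s≤s i≤) with m≤n⇒∃[o]m+o≡n (≤-trans (+-mono-≤ i≤ i≤) (2⌊n/2⌋≤n (suc n′)))
    ... | d , eq = subst₂ _⊏_
      (sym (odd-D≡ n (1 + i) (suc (1 + i + d)) (trans (cong (5 +_) (sym eq)) (arith i d))))
      (sym (odd-D≡ n (2 + i) (1 + i + d) (trans (cong (5 +_) (sym eq)) (arith′ i d))))
      (100⋯.insert-odd-⊏ (1 + i) d)
      where
      arith : ∀ i d → 5 + (i + i + d) ≡ 2 + (1 + i) + suc (1 + i + d)
      arith = solve-∀
      arith′ : ∀ i d → 5 + (i + i + d) ≡ 2 + (2 + i) + (1 + i + d)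
      arith′ = solve-∀

    -- The first word of the next family is 100 with its optimal continuation, that is, without a
    -- second insertion.
    D⊏E : odd-D n (2 + ⌈ n′ /2⌉) ⊏ odd-E n 0
    D⊏E = subst₂ _⊏_
      (sym (odd-D≡ n b c (trans (cong (6 +_) (sym (⌊n/2⌋+⌈n/2⌉≡n n′))) (arith ⌊ n′ /2⌋ ⌈ n′ /2⌉))))
      (cong (λ w → 1b ∷ 0b ∷ 0b ∷ w)
        (trans (cong (⟨10⟩^ b ++_) (opt-even c)) (trans (sym (⟨10⟩-+ b c (1b ∷ 1b ∷ [])))
          (cong (λ t → ⟨10⟩^ t ++ (1b ∷ 1b ∷ [])) (trans (arith′ ⌊ n′ /2⌋ ⌈ n′ /2⌉) (cong (4 +_) (⌊n/2⌋+⌈n/2⌉≡n n′)))))))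
      (100⋯.insert-⊏-opt b (c * 2))
      where
      b = 2 + ⌈ n′ /2⌉
      c = 2 + ⌊ n′ /2⌋
      arith : ∀ x y → 6 + (x + y) ≡ 2 + (2 + y) + (2 + x)
      arith = solve-∀
      arith′ : ∀ x y → 2 + y + (2 + x) ≡ 4 + (x + y)
      arith′ = solve-∀

    E-step : ∀ i → i < 4 + n′ → odd-E n i ⊏ odd-E n (suc i)
    E-step i i< with m≤n⇒∃[o]m+o≡n i<
    ... | o , eq = subst₂ _⊏_
      (sym (odd-E≡ n i (suc o) (cong (2 +_) (trans (sym eq) (sym (+-suc i o))))))
      (sym (odd-E≡ n (suc i) o (cong (2 +_) (sym eq))))
      (∅.insert-even-⊏ (1 + i) o)

    E⊏last : odd-E n (4 + n′) ⊏ ⟨10⟩^ n ++ [ 1b ]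
    E⊏last = subst₂ _⊏_
      (sym (odd-E≡ n (4 + n′) 0 (cong (6 +_) (sym (+-identityʳ n′)))))
      (sym (⟨10⟩-suc (5 + n′) [ 1b ]))
      (∅.011⊏101 (5 + n′))

  even-inOrder : KBitRecordSettersInOrder (n * 2) (map value (evenWords n))
  even-inOrder = recordSettersInOrder (11 + n′ * 2) even-ascending
    (suc-injective (trans (cong length head≡) (cong (4 +_) (length-opt (8 + n′ * 2)))))
    (subst (fib (12 + n′ * 2) <_) (sym (trans (cong ⟦_⟧ head≡) (100⋯.⟦insert⟧ 0 (7 + n′ * 2)))) (fib[6+m]<bound-1-4 (6 + n′ * 2)))
    (λ w |w| → classify-even n (1b ∷ w) (m≤m+n 6 n′) (cong suc |w|) (againstOpt 1b w) w refl)
    where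
    head≡ : even-A n 0 ≡ 1b ∷ 0b ∷ 0b ∷ insert 0 (2 + (3 + n′) * 2)
    head≡ = even-A≡ n 0 (3 + n′) refl

  odd-inOrder : KBitRecordSettersInOrder (1 + n * 2) (map value (oddWords n))
  odd-inOrder = recordSettersInOrder (12 + n′ * 2) odd-ascending
    (suc-injective (trans (cong length head≡) (cong (4 +_) (length-opt (9 + n′ * 2)))))
    (subst (fib (13 + n′ * 2) <_) (sym (trans (cong ⟦_⟧ head≡) (100⋯.⟦insert⟧ 0 (8 + n′ * 2)))) (fib[6+m]<bound-1-4 (7 + n′ * 2)))
    (λ w |w| → classify-odd n (1b ∷ w) (m≤m+n 6 n′) (cong suc |w|) (againstOpt 1b w) w refl)
    where
    head≡ : 1b ∷ 0b ∷ 0b ∷ 0b ∷ ⟨10⟩^ (4 + n′) ++ [ 1b ] ≡ 1b ∷ 0b ∷ 0b ∷ insert 0 (1 + (4 + n′) * 2)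
    head≡ = cong (λ w → 1b ∷ 0b ∷ 0b ∷ 0b ∷ w) (sym (opt-odd (4 + n′)))

  length-evenWords : length (evenWords n) ≡ 8 + n′ + ⌊ n′ /2⌋
  length-evenWords = trans (length-++ (map (even-A n) (range 0 (3 + n′))))
    (trans (cong₂ _+_ (length-map-range (even-A n) 0 (3 + n′))
             (trans (length-++ (map (even-B n) (range 1 ⌊ n /2⌋)))
                    (cong (_+ 1) (length-map-range (even-B n) 1 ⌊ n /2⌋))))
           (arith n′ ⌊ n′ /2⌋))
    where
    arith : ∀ x y → 4 + x + (3 + y + 1) ≡ 8 + x + y
    arith = solve-∀

  length-oddWords : length (oddWords n) ≡ 10 + n′ + ⌈ n′ /2⌉
  length-oddWords = cong (2 +_) (trans (length-++ (map (odd-D n) (range 1 (2 + ⌈ n′ /2⌉))))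
    (trans (cong₂ _+_ (length-map-range (odd-D n) 1 (2 + ⌈ n′ /2⌉))
             (trans (length-++ (map (odd-E n) (range 0 (4 + n′))))
                    (cong (_+ 1) (length-map-range (odd-E n) 0 (4 + n′)))))
           (arith n′ ⌈ n′ /2⌉)))
    where
    arith : ∀ x y → 2 + y + (5 + x + 1) ≡ 8 + x + y
    arith = solve-∀

-- Counting

[r+q*4]/4≡q : ∀ r q → r < 4 → (r + q * 4) / 4 ≡ q
[r+q*4]/4≡q r q r<4 = trans (+-distrib-/-∣ʳ r (n∣m*n q)) (cong₂ _+_ (m<n⇒m/n≡0 r<4) (m*n/n≡m q 4))

open import Data.Integer as ℤ using (+_; -1ℤ)

-1^2m : ∀ m → -1ℤ ℤ.^ (m * 2) ≡ ℤ.1ℤ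
-1^2m zero    = refl
-1^2m (suc m) rewrite -1^2m m = refl

⌊m*2/2⌋ : ∀ m → ⌊ m * 2 /2⌋ ≡ m
⌊m*2/2⌋ zero    = refl
⌊m*2/2⌋ (suc m) = cong suc (⌊m*2/2⌋ m)

⌊1+m*2/2⌋ : ∀ m → ⌊ 1 + m * 2 /2⌋ ≡ m
⌊1+m*2/2⌋ zero    = refl
⌊1+m*2/2⌋ (suc m) = cong suc (⌊1+m*2/2⌋ m)

-1^[1+2m] : ∀ m → -1ℤ ℤ.^ (1 + m * 2) ≡ -1ℤ
-1^[1+2m] m rewrite -1^2m m = refl

Halves : ℕ → Set
Halves m = ∃ λ h → m ≡ h * 2 ⊎ m ≡ 1 + h * 2

halves : ∀ m → Halves m
halves zero          = 0 , inj₁ refl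
halves (suc zero)    = 0 , inj₂ refl
halves (suc (suc m)) with halves m
... | h , inj₁ refl = suc h , inj₁ refl
... | h , inj₂ refl = suc h , inj₂ refl

RecordSetterCount : ℕ → Set
RecordSetterCount k = + numberOfKBitRecordSetters k ≡ + (3 * k / 4) ℤ.- -1ℤ ℤ.^ k

-- The residue of k modulo 4 determines both the rounding in 3k/4 and the sign, so the count is
-- checked in four cases.
recordSetterCount : ∀ k vs r q s → KBitRecordSettersInOrder k vs → 3 * k ≡ r + q * 4 → r < 4 → -1ℤ ℤ.^ k ≡ s →
  + length vs ≡ + q ℤ.- s → RecordSetterCount k
recordSetterCount k vs r q s inOrder 3k≡ r<4 sign eq =
  trans (cong +_ (number≡length k vs inOrder))
    (trans eq (sym (cong₂ (λ x y → + x ℤ.- y) (trans (cong (_/ 4) 3k≡) ([r+q*4]/4≡q r q r<4)) sign)))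

even-count : ∀ n′ → Halves n′ → RecordSetterCount ((6 + n′) * 2)
even-count n′ (h , inj₁ refl) = recordSetterCount ((6 + n′) * 2) (map value (evenWords (6 + n′))) 0 (9 + h * 2 + h) ℤ.1ℤ
  (even-inOrder n′) (arith h) z<s (-1^2m (6 + n′))
  (cong +_ (trans (length-map value (evenWords (6 + n′)))
    (trans (length-evenWords n′) (cong (λ x → 8 + n′ + x) (⌊m*2/2⌋ h)))))
  where
  arith : ∀ h → 3 * ((6 + h * 2) * 2) ≡ 0 + (9 + h * 2 + h) * 4
  arith = solve-∀
even-count n′ (h , inj₂ refl) = recordSetterCount ((6 + n′) * 2) (map value (evenWords (6 + n′))) 2 (10 + h * 2 + h) ℤ.1ℤ
  (even-inOrder n′) (arith h) (s≤s (s≤s z<s)) (-1^2m (6 + n′))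
  (cong +_ (trans (length-map value (evenWords (6 + n′)))
    (trans (length-evenWords n′) (cong (λ x → 8 + n′ + x) (⌊1+m*2/2⌋ h)))))
  where
  arith : ∀ h → 3 * ((7 + h * 2) * 2) ≡ 2 + (10 + h * 2 + h) * 4
  arith = solve-∀

odd-count : ∀ n′ → Halves n′ → RecordSetterCount (1 + (6 + n′) * 2)
odd-count n′ (h , inj₁ refl) = recordSetterCount (1 + (6 + n′) * 2) (map value (oddWords (6 + n′))) 3 (9 + h * 2 + h) -1ℤ
  (odd-inOrder n′) (arith h) ≤-refl (-1^[1+2m] (6 + n′))
  (cong +_ (trans (length-map value (oddWords (6 + n′)))
    (trans (length-oddWords n′) (trans (cong (λ x → 10 + n′ + x) (⌊1+m*2/2⌋ h)) (+-comm 1 (9 + h * 2 + h))))))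
  where
  arith : ∀ h → 3 * (1 + (6 + h * 2) * 2) ≡ 3 + (9 + h * 2 + h) * 4
  arith = solve-∀
odd-count n′ (h , inj₂ refl) = recordSetterCount (1 + (6 + n′) * 2) (map value (oddWords (6 + n′))) 1 (11 + h * 2 + h) -1ℤ
  (odd-inOrder n′) (arith h) (s≤s z<s) (-1^[1+2m] (6 + n′))
  (cong +_ (trans (length-map value (oddWords (6 + n′)))
    (trans (length-oddWords n′) (trans (cong (λ x → 10 + n′ + suc x) (⌊m*2/2⌋ h)) (arith′ h)))))
  where
  arith : ∀ h → 3 * (1 + (7 + h * 2) * 2) ≡ 1 + (11 + h * 2 + h) * 4
  arith = solve-∀
  arith′ : ∀ h → 11 + h * 2 + suc h ≡ 11 + h * 2 + h + 1
  arith′ = solve-∀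

-- Assembling large and small k

≥12⇒halves : ∀ k → 12 ≤ k → ∃ λ n′ → k ≡ (6 + n′) * 2 ⊎ k ≡ 1 + (6 + n′) * 2
≥12⇒halves k 12≤k with m≤n⇒∃[o]m+o≡n 12≤k
... | i , refl with halves i
...   | n′ , inj₁ refl = n′ , inj₁ refl
...   | n′ , inj₂ refl = n′ , inj₂ refl

count : ∀ k → (∃ λ n′ → k ≡ (6 + n′) * 2 ⊎ k ≡ 1 + (6 + n′) * 2) → RecordSetterCount k
count k (n′ , inj₁ refl) = even-count n′ (halves n′)
count k (n′ , inj₂ refl) = odd-count n′ (halves n′)

-- The equation is settled by evaluating the traversal, the order of the list by the decision
-- procedure.
inOrder-by-scan : ∀ k {vs} → proj₁ (scanned k) ≡ vs → {_ : True (linked? _<?_ vs)} →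
  KBitRecordSettersInOrder (suc k) vs
inOrder-by-scan k refl {linked} = scanned-inOrder k (toWitness linked)

theorem1 : KBitRecordSettersInOrder 1 (1 ∷ [])
    × KBitRecordSettersInOrder 2 (3 ∷ [])
    × KBitRecordSettersInOrder 3 (5 ∷ [])
    × KBitRecordSettersInOrder 4 (9 ∷ 11 ∷ [])
    × KBitRecordSettersInOrder 5 (19 ∷ 21 ∷ [])
    × KBitRecordSettersInOrder 6 (35 ∷ 37 ∷ 43 ∷ [])
    × KBitRecordSettersInOrder 7 (69 ∷ 73 ∷ 75 ∷ 83 ∷ 85 ∷ [])
    × KBitRecordSettersInOrder 8 (139 ∷ 147 ∷ 149 ∷ 165 ∷ 171 ∷ [])
    × KBitRecordSettersInOrder 9 (277 ∷ 293 ∷ 299 ∷ 331 ∷ 339 ∷ 341 ∷ [])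
    × KBitRecordSettersInOrder 10 (555 ∷ 587 ∷ 595 ∷ 597 ∷ 661 ∷ 683 ∷ [])
    × KBitRecordSettersInOrder 11 (1109 ∷ 1173 ∷ 1189 ∷ 1195 ∷ 1323 ∷ 1355 ∷ 1363 ∷ 1365 ∷ [])
    × (∀ (k n : ℕ) → 12 ≤ k → k ≡ 2 * n → KBitRecordSettersInOrder k (map value (evenWords n)))
    × (∀ (k n : ℕ) → 12 ≤ k → k ≡ 2 * n + 1 → KBitRecordSettersInOrder k (map value (oddWords n)))
    × (∀ (k : ℕ) → 12 ≤ k → + numberOfKBitRecordSetters k ≡ + (3 * k / 4) ℤ.- -1ℤ ℤ.^ k)
theorem1 =
    inOrder-by-scan 0 refl
  , inOrder-by-scan 1 refl
  , inOrder-by-scan 2 refl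
  , inOrder-by-scan 3 refl
  , inOrder-by-scan 4 refl
  , inOrder-by-scan 5 refl
  , inOrder-by-scan 6 refl
  , inOrder-by-scan 7 refl
  , inOrder-by-scan 8 refl
  , inOrder-by-scan 9 refl
  , inOrder-by-scan 10 refl
  , evens , odds , (λ k 12≤k → count k (≥12⇒halves k 12≤k))
  where
  evens : ∀ k n → 12 ≤ k → k ≡ 2 * n → KBitRecordSettersInOrder k (map value (evenWords n))
  evens k n 12≤k k≡ with m≤n⇒∃[o]m+o≡n (*-cancelˡ-≤ {6} {n} 2 (subst (12 ≤_) k≡ 12≤k))
  ... | n′ , refl = subst (λ k → KBitRecordSettersInOrder k (map value (evenWords n)))
    (sym (trans k≡ (*-comm 2 n))) (even-inOrder n′)

  odds : ∀ k n → 12 ≤ k → k ≡ 2 * n + 1 → KBitRecordSettersInOrder k (map value (oddWords n))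
  -- 12 ≤ 2n + 1 gives 2 · 5 < 2n, hence 6 ≤ n.
  odds k n 12≤k k≡ with m≤n⇒∃[o]m+o≡n (*-cancelˡ-< 2 5 n (≤-pred (subst (12 ≤_) (trans k≡ (+-comm (2 * n) 1)) 12≤k)))
  ... | n′ , refl = subst (λ k → KBitRecordSettersInOrder k (map value (oddWords n)))
    (sym (trans k≡ (trans (+-comm (2 * n) 1) (cong suc (*-comm 2 n))))) (odd-inOrder n′)
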